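{- The number $B(n)$ of prime 2-ball juggling patterns of period $n$ containing the state $\langle1,1\rangle$ satisfies $B(n)\sim\gamma_B2^n$ as $n\to\infty$, where $$\gamma_B=\frac32\sum_{t=1}^\infty\frac{t\,q_t}{2^t}=\frac34\sum_{t=1}^\infty t\left(\frac1{2^t}\prod_{i=2}^t\frac{i-1}{2^i-i-1}\right).$$
   Context: A 2-ball juggling state is a sequence $\alpha=(\alpha_1,\alpha_2,\dots)$ with $\alpha_i\in\{0,1\}$, finitely many nonzero, $\sum_i\alpha_i=2$. There is a transition $\alpha\to\beta$ iff $\alpha_{i+1}\le\beta_i$ for all $i\ge1$. A prime 2-ball juggling pattern of period $n$ is a directed cycle of length $n$ in this state graph, counted up to cyclic rotation. $\langle1,1\rangle=(1,1,0,0,\dots)$. $q_t=\frac12\prod_{i=2}^t\frac{i-1}{2^i-i-1}$. -}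

module Defs where

open import Data.Nat as ℕ using (ℕ; zero; suc; _∸_; _^_; _<_)
import Data.Nat.Properties as ℕP
open import Data.Bool using (Bool; true; false; _∨_; _≤_)
open import Data.Integer using (+_)
open import Data.Rational as ℚ using (ℚ; _/_; ½; 1ℚ; 0ℚ)
open import Data.Product using (Σ; ∃; _×_; _,_)
open import Relation.Binary.PropositionalEquality using (_≡_)
open import Function.Definitions using (Surjective)

-- 2-ball juggling states.
-- A state α = (α₁, α₂, …) with α_i ∈ {0,1}, exactly two entries 1.
-- We encode it by the 0-based positions of its two 1-entries:
-- positions  lo  and  lo + suc gap  (so every record is a valid state and
-- distinct records are distinct states).  Index j of `seq` is α_{j+1}.

record State : Set where
  constructor st
  field
    lo  : ℕ
    gap : ℕ

hi : State → ℕ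
hi (st l g) = l ℕ.+ suc g

-- the 0/1 sequence of a state (0-based: seq α j = α_{j+1})
seq : State → ℕ → Bool
seq α j = (j ℕ.≡ᵇ State.lo α) ∨ (j ℕ.≡ᵇ hi α)

Trans : State → State → Set
Trans α β = ∀ j → seq α (suc j) ≤ seq β j

⟨1,1⟩ : State
⟨1,1⟩ = st 0 0

-- Prime patterns of period n: directed cycles of length n in the state
-- graph, given as an n-periodic walk  s : ℕ → State  whose states
-- s 0, …, s (n-1) are pairwise distinct (a cycle, not a closed walk).

record Cycle (n : ℕ) : Set where
  field
    s        : ℕ → State
    periodic : ∀ i → s (i ℕ.+ n) ≡ s i
    step     : ∀ i → Trans (s i) (s (suc i))
    distinct : ∀ i j → i < n → j < n → s i ≡ s j → i ≡ j

Rotation : ∀ {n} → Cycle n → Cycle n → Set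
Rotation c d = ∃ λ k → ∀ i → Cycle.s d i ≡ Cycle.s c (i ℕ.+ k)

Contains11 : ∀ {n} → Cycle n → Set
Contains11 c = ∃ λ i → Cycle.s c i ≡ ⟨1,1⟩

record Cycle11 (n : ℕ) : Set where
  field
    cyc  : Cycle n
    has  : Contains11 cyc

-- "there are exactly k prime patterns of period n containing ⟨1,1⟩
--  (up to rotation)": a surjection onto Fin k whose fibres are exactly
-- the rotation classes.
open import Data.Fin using (Fin)
open import Function.Bundles using (_⇔_)

CountIs : ℕ → ℕ → Set
CountIs n k = Σ (Cycle11 n → Fin k) λ f →
  Surjective _≡_ _≡_ f ×
  (∀ c d → (f c ≡ f d) ⇔ Rotation (Cycle11.cyc c) (Cycle11.cyc d))

half^ : ℕ → ℚ
half^ zero    = 1ℚ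
half^ (suc t) = ½ ℚ.* half^ t

-- factor (i-1)/(2^i - i - 1) for i = k + 2; denominator written as
-- suc (2^i ∸ i ∸ 2), which equals 2^i - i - 1 since 2^i ≥ i + 2 for i ≥ 2.
factor : ℕ → ℚ
factor k = (+ (suc k)) / suc ((2 ^ (k ℕ.+ 2)) ∸ (k ℕ.+ 2) ∸ 2)

prodQ : ℕ → ℚ
prodQ zero          = 1ℚ
prodQ (suc zero)    = 1ℚ
prodQ (suc (suc k)) = prodQ (suc k) ℚ.* factor k

q : ℕ → ℚ
q t = ½ ℚ.* prodQ t

partial : ℕ → ℚ
partial zero    = 0ℚ
partial (suc M) = partial M ℚ.+ ((+ suc M) / 1) ℚ.* q (suc M) ℚ.* half^ (suc M)

γB-partial : ℕ → ℚ
γB-partial M = ((+ 3) / 2) ℚ.* partial M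

{-# OPTIONS --safe #-}
module Submission where

-- A 2-ball state with a ball about to land is determined by the distance d of its two balls, and the
-- state (lo , d) with lo > 0 falls deterministically to (0 , d).  So a pattern is a cyclic sequence of
-- distinct distances, where the step d → d′ costs d, or d − d′ if d′ < d and the new ball is thrown
-- below the old one.  Maximal chains of steps of the second kind cut the cycle into decreasing
-- blocks, and the costs telescope: the period is the sum of the block maxima.  If ⟨1,1⟩ (d = 1)
-- occurs, start the cycle just after it.
--
-- Deleting the distance 1 from a list of m blocks and decreasing all other distances lowers the
-- cost by m.  Hence the number A m n of lists of m disjoint blocks of cost n satisfies
--   A m n = (m + 1) A m (n − m) + m A (m − 1) (n − m),
-- and, the last distance of the cycle being 1,
--   B n = Σ_{m ≥ 1} (A m (n − m) + A m (n − m − 1))   for n ≥ 2.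
-- After division by 2ⁿ the recursion contracts by 3/4 to the fixed point m q_m, and A m n / 2ⁿ ≤ m / 2
-- dominates the sum over m, so B n / 2ⁿ → Σ m q_m (2⁻ᵐ + 2⁻ᵐ⁻¹) = γ_B.

-- A descent of distances admits both kinds of step, so the distances alone do not determine a
-- pattern; each carries a flag that fixes the blocks. Distance 1 is below all others and can only
-- end a block. In a list of m blocks it is absent, or ends one of m blocks that survive its
-- deletion, or is a block by itself in one of m places: these are the coefficients m + 1 and m.
--
-- Contraction holds for errors measured relative to m. The recursion multiplies a bound
-- proportional to m by ((m + 1) m + m (m - 1)) / (m 2ᵐ) = 2m / 2ᵐ, which is 1 for m = 2 and at most
-- 3/4 for m ≥ 3. For m = 2 the second term has no error, as A 1 n = 2ⁿ⁻¹ exactly for n ≥ 1, and 3/4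
-- is left. One contraction uses up m of the argument n, so the estimate is not uniform in m; hence
-- the sum is cut off at some K before the limit is taken.

open import Defs

-- Words of flagged gaps, counted by removing the gap 0

module Words where

  open import Data.Bool using (Bool; true; false)
  open import Data.Nat
  open import Data.Nat.Properties
  open import Data.Fin using (Fin; zero; suc; toℕ; fromℕ<)
  import Data.Fin.Properties as Fin
  open import Data.List using (List; []; _∷_; map)
  open import Data.List.Relation.Unary.All as All using (All; []; _∷_)
  open import Data.List.Relation.Unary.AllPairs as AllPairs using (AllPairs; []; _∷_)
  import Data.List.Relation.Unary.AllPairs.Properties as AllPairsP
  open import Data.Maybe as Maybe using (Maybe; just; nothing)
  open import Data.Maybe.Properties using (just-injective)
  open import Data.Product using (Σ; ∃; _×_; _,_; proj₁; proj₂; map₂)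
  open import Data.Product.Properties using (,-injectiveˡ; ,-injectiveʳ)
  open import Data.Sum using (_⊎_; inj₁; inj₂)
  open import Data.Unit using (⊤; tt)
  open import Data.Empty using (⊥-elim)
  open import Function using (_∘_)
  open import Relation.Binary.PropositionalEquality

  -- A throw from a state with gap p leading to one with gap g, where gap = distance − 1.  The flag is
  -- true iff the new ball is thrown below the old one, that is, iff g continues the block of p.
  Throw : Set
  Throw = Bool × ℕ

  gap : Throw → ℕ
  gap = proj₂

  Word : Set
  Word = List Throw

  Ok : ℕ → Word → Set
  Ok p []                = ⊤
  Ok p ((true , g) ∷ w)  = g < p × Ok g w
  Ok p ((false , g) ∷ w) = Ok g w

  _#_ : Throw → Throw → Set
  e # f = gap e ≢ gap f

  Distinct : Word → Set
  Distinct = AllPairs _#_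

  -- Words start at gap 0, so that the first flag of a valid word is false.
  Valid : Word → Set
  Valid w = Ok 0 w × Distinct w

  blocks : Word → ℕ
  blocks []                = 0
  blocks ((true , _) ∷ w)  = blocks w
  blocks ((false , _) ∷ w) = suc (blocks w)

  -- Blocks descend, so the maximum of a block sits at its opening throw, the one flagged `false`;
  -- the gap `g` is the distance `suc g`.
  cost : Word → ℕ
  cost []                = 0
  cost ((true , _) ∷ w)  = cost w
  cost ((false , g) ∷ w) = suc g + cost w

  lastGap : ℕ → Word → ℕ
  lastGap p []            = p
  lastGap p ((_ , g) ∷ w) = lastGap g w

  inc : Word → Word
  inc = map (map₂ suc)

  -- Inserts e after the first i blocks.
  ins : ℕ → Throw → Word → Word
  ins i       e []                = e ∷ []
  ins i       e ((true , g) ∷ w)  = (true , g) ∷ ins i e w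
  ins zero    e ((false , g) ∷ w) = e ∷ (false , g) ∷ w
  ins (suc i) e ((false , g) ∷ w) = (false , g) ∷ ins i e w

  -- peel inverts inc and the insertion of a gap 0; look recovers the inserted flag and position.
  peel : Word → Word
  peel []                = []
  peel ((b , zero) ∷ w)  = peel w
  peel ((b , suc g) ∷ w) = (b , g) ∷ peel w

  look : Word → Maybe (Bool × ℕ)
  look []                    = nothing
  look ((b , zero) ∷ w)      = just (b , 0)
  look ((true , suc _) ∷ w)  = look w
  look ((false , suc _) ∷ w) = Maybe.map (map₂ suc) (look w)

  Ok-mono : ∀ {p q} w → p ≤ q → Ok p w → Ok q w
  Ok-mono []                p≤q ok         = tt
  Ok-mono ((true , g) ∷ w)  p≤q (g<p , ok) = <-≤-trans g<p p≤q , ok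
  Ok-mono ((false , g) ∷ w) p≤q ok         = ok

  inc-Ok : ∀ {p} w → Ok p w → Ok (suc p) (inc w)
  inc-Ok []                ok         = tt
  inc-Ok ((true , g) ∷ w)  (g<p , ok) = s≤s g<p , inc-Ok w ok
  inc-Ok ((false , g) ∷ w) ok         = inc-Ok w ok

  inc-Ok₀ : ∀ w → Ok 0 w → Ok 0 (inc w)
  inc-Ok₀ []                ok        = tt
  inc-Ok₀ ((true , g) ∷ w)  (() , _)
  inc-Ok₀ ((false , g) ∷ w) ok        = inc-Ok w ok

  inc-nonzero : ∀ w → All (λ e → 0 ≢ gap e) (inc w)
  inc-nonzero []      = []
  inc-nonzero (e ∷ w) = (λ ()) ∷ inc-nonzero w

  inc-Distinct : ∀ {w} → Distinct w → Distinct (inc w)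
  inc-Distinct d = AllPairsP.map⁺ (AllPairs.map (_∘ suc-injective) d)

  blocks-inc : ∀ w → blocks (inc w) ≡ blocks w
  blocks-inc []                = refl
  blocks-inc ((true , _) ∷ w)  = blocks-inc w
  blocks-inc ((false , _) ∷ w) = cong suc (blocks-inc w)

  -- Only block maxima are paid, and each of them grows by one.
  cost-inc : ∀ w → cost (inc w) ≡ blocks w + cost w
  cost-inc []                = refl
  cost-inc ((true , _) ∷ w)  = cost-inc w
  cost-inc ((false , g) ∷ w) = cong suc (begin
    suc g + cost (inc w)       ≡⟨ cong (suc g +_) (cost-inc w) ⟩
    suc g + (blocks w + cost w) ≡⟨ +-assoc (suc g) (blocks w) (cost w) ⟨
    suc g + blocks w + cost w   ≡⟨ cong (_+ cost w) (+-comm (suc g) (blocks w)) ⟩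
    blocks w + suc g + cost w   ≡⟨ +-assoc (blocks w) (suc g) (cost w) ⟩
    blocks w + (suc g + cost w) ∎)
    where open ≡-Reasoning

  ins-All : ∀ {P : Throw → Set} i {e} w → P e → All P w → All P (ins i e w)
  ins-All i       []                pe pw       = pe ∷ []
  ins-All i       ((true , _) ∷ w)  pe (p ∷ pw) = p ∷ ins-All i w pe pw
  ins-All zero    ((false , _) ∷ w) pe pw       = pe ∷ pw
  ins-All (suc i) ((false , _) ∷ w) pe (p ∷ pw) = p ∷ ins-All i w pe pw

  ins-Distinct : ∀ i {e} w → All (e #_) w → Distinct w → Distinct (ins i e w)
  ins-Distinct i       []                _        _       = [] ∷ []
  ins-Distinct i       ((true , _) ∷ w)  (p ∷ ps) (q ∷ d) = ins-All i w (p ∘ sym) q ∷ ins-Distinct i w ps d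
  ins-Distinct zero    ((false , _) ∷ w) ps       d       = ps ∷ d
  ins-Distinct (suc i) ((false , _) ∷ w) (p ∷ ps) (q ∷ d) = ins-All i w (p ∘ sym) q ∷ ins-Distinct i w ps d

  blocks-ins-true : ∀ i g w → blocks (ins i (true , g) w) ≡ blocks w
  blocks-ins-true i       g []                = refl
  blocks-ins-true i       g ((true , _) ∷ w)  = blocks-ins-true i g w
  blocks-ins-true zero    g ((false , _) ∷ w) = refl
  blocks-ins-true (suc i) g ((false , _) ∷ w) = cong suc (blocks-ins-true i g w)

  blocks-ins-false : ∀ i g w → blocks (ins i (false , g) w) ≡ suc (blocks w)
  blocks-ins-false i       g []                = refl
  blocks-ins-false i       g ((true , _) ∷ w)  = blocks-ins-false i g w
  blocks-ins-false zero    g ((false , _) ∷ w) = refl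
  blocks-ins-false (suc i) g ((false , _) ∷ w) = cong suc (blocks-ins-false i g w)

  cost-ins-true : ∀ i g w → cost (ins i (true , g) w) ≡ cost w
  cost-ins-true i       g []                = refl
  cost-ins-true i       g ((true , _) ∷ w)  = cost-ins-true i g w
  cost-ins-true zero    g ((false , _) ∷ w) = refl
  cost-ins-true (suc i) g ((false , h) ∷ w) = cong (suc h +_) (cost-ins-true i g w)

  cost-ins-false : ∀ i w → cost (ins i (false , 0) w) ≡ suc (cost w)
  cost-ins-false i       []                = refl
  cost-ins-false i       ((true , _) ∷ w)  = cost-ins-false i w
  cost-ins-false zero    ((false , _) ∷ w) = refl
  cost-ins-false (suc i) ((false , h) ∷ w) =
    trans (cong (suc h +_) (cost-ins-false i w)) (+-suc (suc h) (cost w))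

  -- After `inc` the gap 0 is below every other gap, so it may follow any throw with either flag. It
  -- lands on a block boundary, so a throw behind it is flagged `false` and is not constrained by
  -- it.
  ins-Ok : ∀ {p} i b w → Ok (suc p) (inc w) → Ok (suc p) (ins i (b , 0) (inc w))
  ins-Ok i       true  []                ok         = z<s , tt
  ins-Ok i       false []                ok         = tt
  ins-Ok i       b     ((true , g) ∷ w)  (g<p , ok) = g<p , ins-Ok i b w ok
  ins-Ok zero    true  ((false , g) ∷ w) ok         = z<s , ok
  ins-Ok zero    false ((false , g) ∷ w) ok         = ok
  ins-Ok (suc i) b     ((false , g) ∷ w) ok         = ins-Ok i b w ok

  ins-Ok₀-false : ∀ i w → Ok 0 w → Ok 0 (ins i (false , 0) (inc w))
  ins-Ok₀-false i       []                ok       = tt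
  ins-Ok₀-false i       ((true , g) ∷ w)  (() , _)
  ins-Ok₀-false zero    ((false , g) ∷ w) ok       = inc-Ok w ok
  ins-Ok₀-false (suc i) ((false , g) ∷ w) ok       = ins-Ok i false w (inc-Ok w ok)

  ins-Ok₀-true : ∀ i w → i < blocks w → Ok 0 w → Ok 0 (ins (suc i) (true , 0) (inc w))
  ins-Ok₀-true i []                () ok
  ins-Ok₀-true i ((true , g) ∷ w)  _  (() , _)
  ins-Ok₀-true i ((false , g) ∷ w) _  ok       = ins-Ok i true w (inc-Ok w ok)

  ins-Valid-false : ∀ i {w} → Valid w → Valid (ins i (false , 0) (inc w))
  ins-Valid-false i {w} (ok , d) =
    ins-Ok₀-false i w ok , ins-Distinct i (inc w) (inc-nonzero w) (inc-Distinct d)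

  ins-Valid-true : ∀ i {w} → i < blocks w → Valid w → Valid (ins (suc i) (true , 0) (inc w))
  ins-Valid-true i {w} i<b (ok , d) =
    ins-Ok₀-true i w i<b ok , ins-Distinct (suc i) (inc w) (inc-nonzero w) (inc-Distinct d)

  peel-inc : ∀ w → peel (inc w) ≡ w
  peel-inc []      = refl
  peel-inc (e ∷ w) = cong (e ∷_) (peel-inc w)

  peel-ins : ∀ i b w → peel (ins i (b , 0) (inc w)) ≡ w
  peel-ins i       b []                = refl
  peel-ins i       b ((true , g) ∷ w)  = cong ((true , g) ∷_) (peel-ins i b w)
  peel-ins zero    b ((false , g) ∷ w) = cong ((false , g) ∷_) (peel-inc w)
  peel-ins (suc i) b ((false , g) ∷ w) = cong ((false , g) ∷_) (peel-ins i b w)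

  look-inc : ∀ w → look (inc w) ≡ nothing
  look-inc []                = refl
  look-inc ((true , _) ∷ w)  = look-inc w
  look-inc ((false , _) ∷ w) rewrite look-inc w = refl

  look-ins : ∀ i b w → i ≤ blocks w → look (ins i (b , 0) (inc w)) ≡ just (b , i)
  look-ins zero    b []                _       = refl
  look-ins (suc i) b []                ()
  look-ins i       b ((true , g) ∷ w)  i≤      = look-ins i b w i≤
  look-ins zero    b ((false , g) ∷ w) _       = refl
  look-ins (suc i) b ((false , g) ∷ w) (s≤s i≤) rewrite look-ins i b w i≤ = refl

  peel-All : ∀ {P Q : Throw → Set} → (∀ {b g} → P (b , suc g) → Q (b , g)) →
             ∀ w → All P w → All Q (peel w)
  peel-All f []                []       = []
  peel-All f ((b , zero) ∷ w)  (_ ∷ ps) = peel-All f w ps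
  peel-All f ((b , suc g) ∷ w) (p ∷ ps) = f p ∷ peel-All f w ps

  peel-Distinct : ∀ w → Distinct w → Distinct (peel w)
  peel-Distinct []                []      = []
  peel-Distinct ((b , zero) ∷ w)  (_ ∷ d) = peel-Distinct w d
  peel-Distinct ((b , suc g) ∷ w) (p ∷ d) = peel-All (_∘ cong suc) w p ∷ peel-Distinct w d

  peel-Ok : ∀ {p} w → Ok p w → Ok (pred p) (peel w)
  peel-Ok         []                    _             = tt
  peel-Ok         ((true , zero) ∷ w)   (_ , ok)      = Ok-mono (peel w) z≤n (peel-Ok w ok)
  peel-Ok         ((false , zero) ∷ w)  ok            = Ok-mono (peel w) z≤n (peel-Ok w ok)
  peel-Ok {suc p} ((true , suc g) ∷ w)  (s≤s g<p , ok) = g<p , peel-Ok w ok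
  peel-Ok         ((false , suc g) ∷ w) ok            = peel-Ok w ok

  -- The side condition of `one` gives a gap 0 flagged `true` something to continue: a block opened
  -- earlier in the word, or a positive gap `p` in front of it.
  data Peeled (p : ℕ) : Word → Set where
    none : ∀ w → Peeled p (inc w)
    one  : ∀ b i w → i ≤ blocks w → (b ≡ true → 0 < p ⊎ 0 < i) →
           Peeled p (ins i (b , 0) (inc w))

  inc-peel : ∀ w → All (λ e → 0 ≢ gap e) w → inc (peel w) ≡ w
  inc-peel []                []       = refl
  inc-peel ((b , zero) ∷ w)  (p ∷ _)  = ⊥-elim (p refl)
  inc-peel ((b , suc g) ∷ w) (_ ∷ ps) = cong ((b , suc g) ∷_) (inc-peel w ps)

  ins-front : ∀ e w → Ok 0 w → ins 0 e w ≡ e ∷ w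
  ins-front e []                _        = refl
  ins-front e ((true , _) ∷ w)  (() , _)
  ins-front e ((false , _) ∷ w) _        = refl

  -- `Distinct` allows a single gap 0, and no gap lies below it, so a throw behind it opens a new
  -- block. This is why insertion at index 0 puts it back at the front.
  peeled : ∀ {p} w → Ok p w → Distinct w → Peeled p w
  peeled [] _ _ = none []
  peeled {p} ((b , zero) ∷ w) ok (nz ∷ d) =
    subst (Peeled p) (trans (cong (ins 0 (b , 0)) (inc-peel w nz)) (ins-front _ w (ok₀ b ok)))
      (one b 0 (peel w) z≤n (inj₁ ∘ pos b ok))
    where
    ok₀ : ∀ b → Ok p ((b , zero) ∷ w) → Ok 0 w
    ok₀ true  = proj₂
    ok₀ false ok = ok
    pos : ∀ b → Ok p ((b , zero) ∷ w) → b ≡ true → 0 < p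
    pos true (0<p , _) _ = 0<p
  peeled {p} ((true , suc g) ∷ w) (g<p , ok) (_ ∷ d) with peeled w ok d
  ... | none w′         = none ((true , g) ∷ w′)
  ... | one b i w′ i≤ c = one b i ((true , g) ∷ w′) i≤ (λ _ → inj₁ (≤-<-trans z≤n g<p))
  peeled {p} ((false , suc g) ∷ w) ok (_ ∷ d) with peeled w ok d
  ... | none w′         = none ((false , g) ∷ w′)
  ... | one b i w′ i≤ c = one b (suc i) ((false , g) ∷ w′) (s≤s i≤) (λ _ → inj₂ z<s)

  lastGap-inc : ∀ p w → lastGap (suc p) (inc w) ≢ 0
  lastGap-inc p []            = λ ()
  lastGap-inc p ((_ , g) ∷ w) = lastGap-inc g w

  lastGap-top : ∀ p b w → lastGap p (ins (blocks w) (b , 0) (inc w)) ≡ 0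
  lastGap-top p b []                = refl
  lastGap-top p b ((true , g) ∷ w)  = lastGap-top (suc g) b w
  lastGap-top p b ((false , g) ∷ w) = lastGap-top (suc g) b w

  -- The word still ends in a gap raised by `inc`. Together with `lastGap-top`, a final gap 0 pins
  -- the insertion index to `blocks w`, so a whole period leaves only the flag to choose.
  lastGap-below : ∀ p i b w → i < blocks w → lastGap p (ins i (b , 0) (inc w)) ≢ 0
  lastGap-below p i       b []                ()
  lastGap-below p i       b ((true , g) ∷ w)  i<       = lastGap-below (suc g) i b w i<
  lastGap-below p zero    b ((false , g) ∷ w) i<       = lastGap-inc g w
  lastGap-below p (suc i) b ((false , g) ∷ w) (s≤s i<) = lastGap-below (suc g) i b w i<

  -- Code m n encodes the valid words with m blocks and cost n.  For n < m the truncated n ∸ m is 0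
  -- and, Code (suc m) 0 being empty, keep and new do not apply.
  data Code : ℕ → ℕ → Set where
    nil  : Code 0 0
    keep : ∀ {m n} → Fin (2 + m) → Code (suc m) (n ∸ m) → Code (suc m) (suc n)
    new  : ∀ {m n} → Fin (1 + m) → Code m (n ∸ m) → Code (suc m) (suc n)

  Code₀ : ∀ {n} → Code 0 n → n ≡ 0
  Code₀ nil = refl

  -- The m + 1 ways to preserve the number m of blocks: no gap 0, or a gap 0 at the end of one of
  -- the blocks. The index passed to `ins` is a successor because a throw flagged `true` needs a
  -- block before it.
  extend : ∀ {m} → Fin (suc m) → Word → Word
  extend zero    w = inc w
  extend (suc i) w = ins (suc (toℕ i)) (true , 0) (inc w)

  decode : ∀ {m n} → Code m n → Word
  decode nil        = []
  decode (keep i c) = extend i (decode c)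
  decode (new i c)  = ins (toℕ i) (false , 0) (inc (decode c))

  Code-positive : ∀ {m n} → Code (suc m) n → 0 < n
  Code-positive (keep _ _) = z<s
  Code-positive (new _ _)  = z<s

  Code-∸-positive : ∀ {m n k} → Code (suc m) (n ∸ k) → k < n
  Code-∸-positive {k = k} c = ≰⇒> λ n≤k → n≮0 (subst (0 <_) (m≤n⇒m∸n≡0 n≤k) (Code-positive c))

  Code-∸-≤ : ∀ m {n} → Code m (n ∸ m) → m ≤ n
  Code-∸-≤ zero    c = z≤n
  Code-∸-≤ (suc m) c = <⇒≤ (Code-∸-positive c)

  blocks-decode : ∀ {m n} (c : Code m n) → blocks (decode c) ≡ m
  blocks-decode nil              = refl
  blocks-decode (keep zero c)    = trans (blocks-inc (decode c)) (blocks-decode c)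
  blocks-decode (keep (suc i) c) =
    trans (blocks-ins-true _ 0 (inc (decode c))) (trans (blocks-inc (decode c)) (blocks-decode c))
  blocks-decode (new i c)        =
    trans (blocks-ins-false _ 0 (inc (decode c))) (cong suc (trans (blocks-inc (decode c)) (blocks-decode c)))

  cost-decode : ∀ {m n} (c : Code m n) → cost (decode c) ≡ n

  cost-inc-decode : ∀ {m n} (c : Code m n) → cost (inc (decode c)) ≡ m + n
  cost-inc-decode c = trans (cost-inc (decode c)) (cong₂ _+_ (blocks-decode c) (cost-decode c))

  cost-decode nil              = refl
  cost-decode {suc m} (keep zero c) =
    trans (cost-inc-decode c) (cong suc (m+[n∸m]≡n (<⇒≤ (Code-∸-positive {k = m} c))))
  cost-decode {suc m} (keep (suc i) c) =
    trans (cost-ins-true _ 0 (inc (decode c)))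
      (trans (cost-inc-decode c) (cong suc (m+[n∸m]≡n (<⇒≤ (Code-∸-positive {k = m} c)))))
  cost-decode {suc m} (new i c) =
    trans (cost-ins-false _ (inc (decode c)))
      (cong suc (trans (cost-inc-decode c) (m+[n∸m]≡n (Code-∸-≤ m c))))

  decode-Valid : ∀ {m n} (c : Code m n) → Valid (decode c)
  decode-Valid nil              = tt , []
  decode-Valid (keep zero c)    =
    inc-Ok₀ (decode c) (proj₁ (decode-Valid c)) , inc-Distinct (proj₂ (decode-Valid c))
  decode-Valid (keep (suc i) c) =
    ins-Valid-true (toℕ i) (subst (toℕ i <_) (sym (blocks-decode c)) (Fin.toℕ<n i)) (decode-Valid c)
  decode-Valid (new i c)        = ins-Valid-false (toℕ i) (decode-Valid c)

  key : ∀ {m n} → Code m n → Maybe (Bool × ℕ)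
  key nil              = nothing
  key (keep zero c)    = nothing
  key (keep (suc i) c) = just (true , suc (toℕ i))
  key (new i c)        = just (false , toℕ i)

  look-decode : ∀ {m n} (c : Code m n) → look (decode c) ≡ key c
  look-decode nil              = refl
  look-decode (keep zero c)    = look-inc (decode c)
  look-decode (keep (suc i) c) =
    look-ins _ true (decode c) (subst (suc (toℕ i) ≤_) (sym (blocks-decode c)) (Fin.toℕ<n i))
  look-decode (new i c)        =
    look-ins _ false (decode c) (subst (toℕ i ≤_) (sym (blocks-decode c)) (Fin.toℕ≤pred[n] i))

  peel-extend : ∀ {m} (i : Fin (suc m)) w → peel (extend i w) ≡ w
  peel-extend zero    w = peel-inc w
  peel-extend (suc i) w = peel-ins _ true w

  key-keep : ∀ {m n} i j (c d : Code (suc m) (n ∸ m)) →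
             key (keep {m} {n} i c) ≡ key (keep {m} {n} j d) → i ≡ j
  key-keep zero    zero    c d eq = refl
  key-keep (suc i) (suc j) c d eq =
    cong suc (Fin.toℕ-injective (suc-injective (,-injectiveʳ (just-injective eq))))

  key-≡ : ∀ {m n} (c d : Code m n) → decode c ≡ decode d → key c ≡ key d
  key-≡ c d eq = trans (sym (look-decode c)) (trans (cong look eq) (look-decode d))

  keep≢new : ∀ {m n} i j (c : Code (suc m) (n ∸ m)) (d : Code m (n ∸ m)) →
             key (keep {m} {n} i c) ≢ key (new {m} {n} j d)
  keep≢new zero    j c d ()
  keep≢new (suc i) j c d ()

  -- `look` reveals the outermost constructor and its index, in the form of `key`, and `peel` strips
  -- that constructor off.
  decode-injective : ∀ {m n} (c d : Code m n) → decode c ≡ decode d → c ≡ d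
  decode-injective nil nil eq = refl
  decode-injective (keep i c) (keep j d) eq = cong₂ keep
    (key-keep i j c d (key-≡ (keep i c) (keep j d) eq))
    (decode-injective c d (trans (sym (peel-extend i (decode c))) (trans (cong peel eq) (peel-extend j (decode d)))))
  decode-injective (keep i c) (new j d) eq = ⊥-elim (keep≢new i j c d (key-≡ (keep i c) (new j d) eq))
  decode-injective (new i c) (keep j d) eq = ⊥-elim (keep≢new j i d c (key-≡ (keep j d) (new i c) (sym eq)))
  decode-injective (new i c) (new j d) eq = cong₂ new
    (Fin.toℕ-injective (,-injectiveʳ (just-injective (key-≡ (new i c) (new j d) eq))))
    (decode-injective c d (trans (sym (peel-ins _ false (decode c)))
      (trans (cong peel eq) (peel-ins _ false (decode d)))))

  Encoding : ℕ → ℕ → Word → Set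
  Encoding m n w = Σ (Code m n) λ c → decode c ≡ w

  decode-subst₂ : ∀ {m k n l} (p : m ≡ k) (q : n ≡ l) (c : Code m n) → decode (subst₂ Code p q c) ≡ decode c
  decode-subst₂ refl refl c = refl

  encode-keep : ∀ {m n w} (i : Fin (2 + m)) → Encoding (suc m) n w →
                Encoding (suc m) (suc m + n) (extend i w)
  encode-keep {m} {n} i (c , refl) =
    keep i (subst₂ Code refl n≡ c) , cong (extend i) (decode-subst₂ refl n≡ c)
    where
    n≡ : n ≡ m + n ∸ m
    n≡ = sym (m+n∸m≡n m n)

  encode-new : ∀ {m n w} (i : Fin (1 + m)) → Encoding m n w →
               Encoding (suc m) (suc (m + n)) (ins (toℕ i) (false , 0) (inc w))
  encode-new {m} {n} i (c , refl) =
    new i (subst₂ Code refl n≡ c) , cong (ins (toℕ i) (false , 0) ∘ inc) (decode-subst₂ refl n≡ c)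
    where
    n≡ : n ≡ m + n ∸ m
    n≡ = sym (m+n∸m≡n m n)

  Valid-peel : ∀ {w} → Valid w → Valid (peel w)
  Valid-peel {w} (ok , d) = peel-Ok w ok , peel-Distinct w d

  EncodingOf : Word → Set
  EncodingOf w = Encoding (blocks w) (cost w) w

  encode-inc : ∀ w → Ok 0 w → EncodingOf w → EncodingOf (inc w)
  encode-inc []                _        _ = nil , refl
  encode-inc ((true , _) ∷ _)  (() , _) _
  encode-inc w@((false , _) ∷ _) _      e =
    subst₂ (λ m n → Encoding m n (inc w)) (sym (blocks-inc w)) (sym (cost-inc w)) (encode-keep zero e)

  encode-join : ∀ i w → i < blocks w → EncodingOf w → EncodingOf (ins (suc i) (true , 0) (inc w))
  encode-join i w i<b e = subst₂ (λ m n → Encoding m n (ins (suc i) (true , 0) (inc w)))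
    (sym (trans (blocks-ins-true _ 0 (inc w)) (blocks-inc w)))
    (sym (trans (cost-ins-true _ 0 (inc w)) (cost-inc w)))
    (join (blocks w) i<b e)
    where
    join : ∀ m → i < m → Encoding m (cost w) w →
           Encoding m (m + cost w) (ins (suc i) (true , 0) (inc w))
    join (suc m) i<m e =
      subst (λ j → Encoding _ _ (ins (suc j) (true , 0) (inc w))) (Fin.toℕ-fromℕ< i<m)
        (encode-keep (suc (fromℕ< i<m)) e)

  encode-single : ∀ i w → i ≤ blocks w → EncodingOf w → EncodingOf (ins i (false , 0) (inc w))
  encode-single i w i≤b e = subst₂ (λ m n → Encoding m n (ins i (false , 0) (inc w)))
    (sym (trans (blocks-ins-false _ 0 (inc w)) (cong suc (blocks-inc w))))
    (sym (trans (cost-ins-false _ (inc w)) (cong suc (cost-inc w))))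
    (subst (λ j → Encoding _ _ (ins j (false , 0) (inc w))) (Fin.toℕ-fromℕ< (s≤s i≤b))
      (encode-new (fromℕ< (s≤s i≤b)) e))

  -- The induction runs on a bound for the gaps and not on the length: without a gap 0, `peel` keeps
  -- the length but still lowers every gap.
  encode-bounded : ∀ h w → All (λ e → gap e < h) w → Valid w → EncodingOf w
  encode-bounded zero    []      _        _ = nil , refl
  encode-bounded zero    (_ ∷ _) (() ∷ _) _
  encode-bounded (suc h) w       bd       v = step (peeled w (proj₁ v) (proj₂ v)) (Valid-peel v)
    (encode-bounded h (peel w) (peel-All s≤s⁻¹ w bd) (Valid-peel v))
    where
    step : ∀ {w} → Peeled 0 w → Valid (peel w) → EncodingOf (peel w) → EncodingOf w
    step (none w) v e rewrite peel-inc w = encode-inc w (proj₁ v) e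
    step (one false i w i≤b _) v e rewrite peel-ins i false w = encode-single i w i≤b e
    step (one true i w i≤b c) v e rewrite peel-ins i true w with i | c refl
    ... | zero  | inj₁ ()
    ... | zero  | inj₂ ()
    ... | suc j | _ = encode-join j w i≤b e

  bound : ∀ w → ∃ λ h → All (λ e → gap e < h) w
  bound []      = 0 , []
  bound (e ∷ w) with bound w
  ... | h , bd = suc (gap e) ⊔ h , m≤m⊔n (suc (gap e)) h ∷ All.map (λ lt → <-≤-trans lt (m≤n⊔m (suc (gap e)) h)) bd

  encode : ∀ w → Valid w → EncodingOf w
  encode w v = encode-bounded (proj₁ (bound w)) w (proj₂ (bound w)) v

  -- The words of a whole period: the final gap 0 continues the last block, or is a block of its own.
  Full : ℕ → Set
  Full n = Σ (Fin n) λ m → Code (suc (toℕ m)) (n ∸ suc (toℕ m)) ⊎ Code (suc (toℕ m)) (n ∸ (2 + toℕ m))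

  decodeFull : ∀ {n} → Full n → Word
  decodeFull (m , inj₁ c) = ins (suc (toℕ m)) (true , 0) (inc (decode c))
  decodeFull (m , inj₂ c) = ins (suc (toℕ m)) (false , 0) (inc (decode c))

  decodeFull-Valid : ∀ {n} (c : Full n) → Valid (decodeFull c)
  decodeFull-Valid (m , inj₁ c) =
    ins-Valid-true (toℕ m) (≤-reflexive (sym (blocks-decode c))) (decode-Valid c)
  decodeFull-Valid (m , inj₂ c) = ins-Valid-false (suc (toℕ m)) (decode-Valid c)

  cost-decodeFull : ∀ {n} (c : Full n) → cost (decodeFull c) ≡ n
  cost-decodeFull (m , inj₁ c) = trans (cost-ins-true (suc (toℕ m)) 0 (inc (decode c)))
    (trans (cost-inc-decode c) (m+[n∸m]≡n (Fin.toℕ<n m)))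
  cost-decodeFull (m , inj₂ c) = trans (cost-ins-false (suc (toℕ m)) (inc (decode c)))
    (trans (cong suc (cost-inc-decode c)) (m+[n∸m]≡n (<⇒≤ (Code-∸-positive {k = 2 + toℕ m} c))))

  lastGap-decodeFull : ∀ {n} p (c : Full n) → lastGap p (decodeFull c) ≡ 0
  lastGap-decodeFull p (m , inj₁ c) = subst (λ b → lastGap p (ins b _ (inc (decode c))) ≡ 0)
    (blocks-decode c) (lastGap-top p true (decode c))
  lastGap-decodeFull p (m , inj₂ c) = subst (λ b → lastGap p (ins b _ (inc (decode c))) ≡ 0)
    (blocks-decode c) (lastGap-top p false (decode c))

  flag : ∀ {n} → Full n → Bool
  flag (_ , inj₁ _) = true
  flag (_ , inj₂ _) = false

  look-decodeFull : ∀ {n} (c : Full n) → look (decodeFull c) ≡ just (flag c , suc (toℕ (proj₁ c)))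
  look-decodeFull (m , inj₁ c) = look-ins (suc (toℕ m)) true (decode c) (≤-reflexive (sym (blocks-decode c)))
  look-decodeFull (m , inj₂ c) = look-ins (suc (toℕ m)) false (decode c) (≤-reflexive (sym (blocks-decode c)))

  look-decodeFull-≡ : ∀ {n} (c d : Full n) → decodeFull c ≡ decodeFull d →
                      (flag c , suc (toℕ (proj₁ c))) ≡ (flag d , suc (toℕ (proj₁ d)))
  look-decodeFull-≡ c d eq =
    just-injective (trans (sym (look-decodeFull c)) (trans (cong look eq) (look-decodeFull d)))

  ins-inc-injective : ∀ i b {v w} → ins i (b , 0) (inc v) ≡ ins i (b , 0) (inc w) → v ≡ w
  ins-inc-injective i b {v} {w} eq = trans (sym (peel-ins i b v)) (trans (cong peel eq) (peel-ins i b w))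

  decodeFull-injective : ∀ {n} (c d : Full n) → decodeFull c ≡ decodeFull d → c ≡ d
  decodeFull-injective c@(m , x) d@(k , y) eq
    with Fin.toℕ-injective (suc-injective (,-injectiveʳ (look-decodeFull-≡ c d eq)))
  decodeFull-injective c@(m , inj₁ x) d@(.m , inj₁ y) eq | refl =
    cong (λ z → m , inj₁ z) (decode-injective x y (ins-inc-injective (suc (toℕ m)) true eq))
  decodeFull-injective c@(m , inj₂ x) d@(.m , inj₂ y) eq | refl =
    cong (λ z → m , inj₂ z) (decode-injective x y (ins-inc-injective (suc (toℕ m)) false eq))
  decodeFull-injective c@(m , inj₁ x) d@(.m , inj₂ y) eq | refl with ,-injectiveˡ (look-decodeFull-≡ c d eq)
  ... | ()
  decodeFull-injective c@(m , inj₂ x) d@(.m , inj₁ y) eq | refl with ,-injectiveˡ (look-decodeFull-≡ c d eq)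
  ... | ()

  EncodingFull : ℕ → Word → Set
  EncodingFull n w = Σ (Full n) λ c → decodeFull c ≡ w

  encodeFull-join : ∀ {m k} n w → suc m + k ≡ n → Encoding (suc m) k w →
                    EncodingFull n (ins (suc m) (true , 0) (inc w))
  encodeFull-join {m} {k} n w refl (c , refl) =
    (i , inj₁ (subst₂ Code (cong suc (sym i≡)) k≡ c)) ,
    cong₂ (λ j v → ins (suc j) (true , 0) (inc v)) i≡ (decode-subst₂ (cong suc (sym i≡)) k≡ c)
    where
    i = fromℕ< (m≤m+n (suc m) k)
    i≡ : toℕ i ≡ m
    i≡ = Fin.toℕ-fromℕ< (m≤m+n (suc m) k)
    k≡ : k ≡ m + k ∸ toℕ i
    k≡ = trans (sym (m+n∸m≡n m k)) (cong (m + k ∸_) (sym i≡))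

  encodeFull-single : ∀ {m k} n w → 2 + m + k ≡ n → Encoding (suc m) k w →
                    EncodingFull n (ins (suc m) (false , 0) (inc w))
  encodeFull-single {m} {k} n w refl (c , refl) =
    (i , inj₂ (subst₂ Code (cong suc (sym i≡)) k≡ c)) ,
    cong₂ (λ j v → ins (suc j) (false , 0) (inc v)) i≡ (decode-subst₂ (cong suc (sym i≡)) k≡ c)
    where
    m<n : m < 2 + m + k
    m<n = s≤s (≤-trans (m≤m+n m k) (n≤1+n (m + k)))
    i = fromℕ< m<n
    i≡ : toℕ i ≡ m
    i≡ = Fin.toℕ-fromℕ< m<n
    k≡ : k ≡ m + k ∸ toℕ i
    k≡ = trans (sym (m+n∸m≡n m k)) (cong (m + k ∸_) (sym i≡))

  encodeFull : ∀ n w → 2 ≤ n → Valid w → lastGap 0 w ≡ 0 → cost w ≡ n → EncodingFull n w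
  encodeFull n w 2≤n v last≡ cost≡ = go (peeled w (proj₁ v) (proj₂ v)) (Valid-peel v) last≡ cost≡
    where
    go : ∀ {w} → Peeled 0 w → Valid (peel w) → lastGap 0 w ≡ 0 → cost w ≡ n → EncodingFull n w
    go (none [])      v last≡ refl = ⊥-elim (n≮0 2≤n)
    go (none (e ∷ w)) v last≡ _    = ⊥-elim (lastGap-inc (gap e) w last≡)
    go (one b i w i≤b c) v last≡ cost≡ rewrite peel-ins i b w with m≤n⇒m<n∨m≡n i≤b
    ... | inj₁ i<b  = ⊥-elim (lastGap-below 0 i b w i<b last≡)
    go (one true i w i≤b c) v last≡ cost≡ | inj₂ refl =
      join (blocks w) (c refl) (trans (sym (trans (cost-ins-true (blocks w) 0 (inc w)) (cost-inc w))) cost≡) (encode w v)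
      where
      join : ∀ m → 0 < 0 ⊎ 0 < m → m + cost w ≡ n → Encoding m (cost w) w → EncodingFull n (ins m (true , 0) (inc w))
      join (suc m) _ eq e = encodeFull-join n w eq e
      join zero (inj₁ ())
      join zero (inj₂ ())
    go (one false i w i≤b c) v last≡ cost≡ | inj₂ refl =
      single (blocks w) (trans (sym (trans (cost-ins-false (blocks w) (inc w)) (cong suc (cost-inc w)))) cost≡) (encode w v)
      where
      single : ∀ m → suc (m + cost w) ≡ n → Encoding m (cost w) w → EncodingFull n (ins m (false , 0) (inc w))
      single (suc m) eq e = encodeFull-single n w eq e
      -- A gap 0 alone is the fixed point ⟨1,1⟩, a pattern of period 1. `Full` omits it, whence the
      -- hypothesis `2 ≤ n`.
      single zero eq (c , _) = ⊥-elim (<⇒≱ 2≤n (≤-reflexive (trans (sym eq) (cong suc (Code₀ c)))))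

-- Cycles through ⟨1,1⟩ and their words

module Loops where

  open import Data.Bool using (Bool; true; false; f≤t; b≤b)
  open import Data.Bool.Properties using (T-≡)
  open import Data.Nat
  open import Data.Nat.DivMod
  open import Data.Nat.Properties
  open import Data.List using (List; []; _∷_; length; applyUpTo)
  open import Data.List.Properties using (∷-injective; length-applyUpTo)
  open import Data.List.Relation.Unary.All as All using (All; []; _∷_)
  open import Data.List.Relation.Unary.AllPairs using ([]; _∷_)
  import Data.List.Relation.Unary.AllPairs.Properties as AllPairsP
  open import Data.List.Relation.Unary.Linked using (Linked; []; [-]; _∷_)
  import Data.List.Relation.Unary.Linked.Properties as LinkedP
  open import Data.List.Relation.Unary.Unique.Propositional using (Unique)
  open import Data.Product using (Σ; ∃; _×_; _,_; proj₁; proj₂)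
  open import Data.Sum using (_⊎_; inj₁; inj₂)
  open import Data.Unit using (tt)
  open import Data.Empty using (⊥-elim)
  open import Function using (_∘_)
  open import Function.Bundles using (module Equivalence)
  open import Relation.Binary.PropositionalEquality
  open Words

  seq-lo : ∀ l g → seq (st l g) l ≡ true
  seq-lo l g rewrite Equivalence.to T-≡ (≡⇒≡ᵇ l l refl) = refl

  seq-hi : ∀ l g → seq (st l g) (l + suc g) ≡ true
  seq-hi l g with (l + suc g) ≡ᵇ l
  ... | true  = refl
  ... | false = Equivalence.to T-≡ (≡⇒≡ᵇ (l + suc g) (l + suc g) refl)

  seq-true : ∀ l g j → seq (st l g) j ≡ true → j ≡ l ⊎ j ≡ l + suc g
  seq-true l g j eq with j ≡ᵇ l in j≡ᵇl
  ... | true  = inj₁ (≡ᵇ⇒≡ j l (Equivalence.from T-≡ j≡ᵇl))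
  ... | false = inj₂ (≡ᵇ⇒≡ j (l + suc g) (Equivalence.from T-≡ eq))

  Trans⁺ : ∀ α β → (∀ j → seq α (suc j) ≡ true → seq β j ≡ true) → Trans α β
  Trans⁺ α β h j with seq α (suc j) | seq β j | h j
  ... | false | false | _ = b≤b
  ... | false | true  | _ = f≤t
  ... | true  | true  | _ = b≤b
  ... | true  | false | k with k refl
  ... | ()

  Trans⁻ : ∀ α β → Trans α β → ∀ j → seq α (suc j) ≡ true → seq β j ≡ true
  Trans⁻ α β t j eq with seq α (suc j) | seq β j | t j
  Trans⁻ α β t j refl | true | true | b≤b = refl

  Trans-fall : ∀ l g → Trans (st (suc l) g) (st l g)
  Trans-fall l g = Trans⁺ (st (suc l) g) (st l g) λ j eq → case j (seq-true (suc l) g (suc j) eq)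
    where
    case : ∀ j → suc j ≡ suc l ⊎ suc j ≡ suc l + suc g → seq (st l g) j ≡ true
    case j (inj₁ refl) = seq-lo l g
    case j (inj₂ refl) = seq-hi l g

  Trans-throw : ∀ {p} l g → l ≡ p ⊎ l + suc g ≡ p → Trans (st 0 p) (st l g)
  Trans-throw {p} l g h = Trans⁺ (st 0 p) (st l g) λ j eq → case h (seq-true 0 p (suc j) eq)
    where
    case : ∀ {j} → l ≡ p ⊎ l + suc g ≡ p → suc j ≡ 0 ⊎ suc j ≡ suc p → seq (st l g) j ≡ true
    case (inj₁ refl) (inj₂ refl) = seq-lo l g
    case (inj₂ refl) (inj₂ refl) = seq-hi l g

  -- Both balls stay in the air, and they already account for the two ones of `β`.
  Trans-fall⁻ : ∀ l g β → Trans (st (suc l) g) β → β ≡ st l g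
  Trans-fall⁻ l g (st k h) t
    with seq-true k h l (Trans⁻ (st (suc l) g) (st k h) t l (seq-lo (suc l) g))
       | seq-true k h (l + suc g) (Trans⁻ (st (suc l) g) (st k h) t (l + suc g) (seq-hi (suc l) g))
  ... | inj₁ refl | inj₁ eq = ⊥-elim (m+1+n≢m l eq)
  ... | inj₁ refl | inj₂ eq = cong (st l) (sym (suc-injective (+-cancelˡ-≡ l (suc g) (suc h) eq)))
  ... | inj₂ refl | inj₁ eq = ⊥-elim (m+1+n≢m k (trans (sym (+-assoc k (suc h) (suc g))) eq))
  ... | inj₂ refl | inj₂ eq = ⊥-elim (m+1+n≢m (k + suc h) eq)

  Trans-throw⁻ : ∀ p l g → Trans (st 0 p) (st l g) → p ≡ l ⊎ p ≡ l + suc g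
  Trans-throw⁻ p l g t = seq-true l g p (Trans⁻ (st 0 p) (st l g) t p (seq-hi 0 p))

  -- After a landing with gap `p` the other ball is at height `p`. It is the lower ball of the next
  -- state if the flag is `false`, and the upper one, `suc g` above the new ball, if it is `true`.
  low : Bool → ℕ → ℕ → ℕ
  low false p g = p
  low true  p g = p ∸ suc g

  walk : ℕ → Word → ℕ
  walk p []            = 0
  walk p ((b , g) ∷ w) = suc (low b p g) + walk g w

  -- The states following st l g.
  render : ℕ → ℕ → Word → List State
  render (suc l) g w             = st l g ∷ render l g w
  render zero    p []            = []
  render zero    p ((b , g) ∷ w) = st (low b p g) g ∷ render (low b p g) g w

  final : State → List State → State
  final α []      = α
  final α (β ∷ L) = final β L

  length-render : ∀ l g w → length (render l g w) ≡ l + walk g w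
  length-render (suc l) g w             = cong suc (length-render l g w)
  length-render zero    p []            = refl
  length-render zero    p ((b , g) ∷ w) = cong suc (length-render (low b p g) g w)

  -- The telescoping sum. The distance `suc p` is brought in at the start, and the last distance is
  -- still to be paid at the end; from gap 0 back to gap 0 both are 1 and cancel.
  walk-cost : ∀ {p} w → Ok p w → walk p w + suc (lastGap p w) ≡ suc p + cost w
  walk-cost {p} [] _ = cong suc (sym (+-identityʳ p))
  walk-cost {p} ((false , g) ∷ w) ok =
    cong suc (trans (+-assoc p (walk g w) _) (cong (p +_) (walk-cost w ok)))
  walk-cost {p} ((true , g) ∷ w) (g<p , ok) = cong suc (begin
    p ∸ suc g + walk g w + suc (lastGap g w)   ≡⟨ +-assoc (p ∸ suc g) (walk g w) _ ⟩
    p ∸ suc g + (walk g w + suc (lastGap g w)) ≡⟨ cong (p ∸ suc g +_) (walk-cost w ok) ⟩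
    p ∸ suc g + (suc g + cost w)               ≡⟨ +-assoc (p ∸ suc g) (suc g) (cost w) ⟨
    p ∸ suc g + suc g + cost w                 ≡⟨ cong (_+ cost w) (m∸n+n≡m g<p) ⟩
    p + cost w                                 ∎)
    where open ≡-Reasoning

  render-Linked : ∀ l g w → Ok g w → Linked Trans (st l g ∷ render l g w)
  render-Linked (suc l) g w ok = Trans-fall l g ∷ render-Linked l g w ok
  render-Linked zero p [] ok = [-]
  render-Linked zero p ((false , g) ∷ w) ok =
    Trans-throw p g (inj₁ refl) ∷ render-Linked p g w ok
  render-Linked zero p ((true , g) ∷ w) (g<p , ok) =
    Trans-throw (p ∸ suc g) g (inj₂ (m∸n+n≡m g<p)) ∷ render-Linked (p ∸ suc g) g w ok

  final-render : ∀ l g w → final (st l g) (render l g w) ≡ st 0 (lastGap g w)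
  final-render (suc l) g w             = final-render l g w
  final-render zero    p []            = refl
  final-render zero    p ((b , g) ∷ w) = final-render (low b p g) g w

  render-avoids : ∀ {h} l g w → h ≢ g → All (λ e → h ≢ gap e) w →
                  All (λ β → h ≢ State.gap β) (render l g w)
  render-avoids (suc l) g w             h≢g ps       = h≢g ∷ render-avoids l g w h≢g ps
  render-avoids zero    p []            _   _        = []
  render-avoids zero    p ((b , g) ∷ w) _   (q ∷ ps) = q ∷ render-avoids (low b p g) g w q ps

  -- During the fall the gap stays `g` while the height drops strictly below `k`; afterwards the gap
  -- differs from `g`.
  render-fresh : ∀ {k} l g w → l ≤ k → All (λ e → g ≢ gap e) w →
                 All (st k g ≢_) (render l g w)
  render-fresh (suc l) g w l≤k ps = (λ { refl → 1+n≰n l≤k }) ∷ render-fresh l g w (<⇒≤ l≤k) ps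
  render-fresh zero p [] _ _ = []
  render-fresh zero p ((b , g) ∷ w) _ (q ∷ ps) =
    (q ∘ cong State.gap) ∷ All.map (_∘ cong State.gap) (render-avoids (low b p g) g w q ps)

  render-Unique : ∀ l g w → All (λ e → g ≢ gap e) w → Distinct w → Unique (render l g w)
  render-Unique (suc l) g w ps d = render-fresh l g w ≤-refl ps ∷ render-Unique l g w ps d
  render-Unique zero p [] _ _ = []
  render-Unique zero p ((b , g) ∷ w) _ (ps ∷ d) =
    render-fresh (low b p g) g w ≤-refl ps ∷ render-Unique (low b p g) g w ps d

  -- At l = 0 the hypothesis on gaps of render-Unique can be dropped: no state with gap p occurs.
  render₀-Unique : ∀ p w → Distinct w → Unique (render 0 p w)
  render₀-Unique p [] _ = []
  render₀-Unique p ((b , g) ∷ w) (ps ∷ d) =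
    render-fresh (low b p g) g w ≤-refl ps ∷ render-Unique (low b p g) g w ps d

  -- The two kinds of throw to the same gap `g < p` differ in height, since `p ∸ suc g` is less than
  -- `p`.
  low-injective : ∀ {p g} a b v w → Ok p ((a , g) ∷ v) → Ok p ((b , g) ∷ w) →
                  low a p g ≡ low b p g → a ≡ b
  low-injective false false v w _ _ _ = refl
  low-injective true  true  v w _ _ _ = refl
  low-injective {g = g} true  false v w (s≤s {n = p} g≤p , _) _ eq = ⊥-elim (1+n≰n (≤-trans (≤-reflexive (sym eq)) (m∸n≤m p g)))
  low-injective {g = g} false true  v w _ (s≤s {n = p} g≤p , _) eq = ⊥-elim (1+n≰n (≤-trans (≤-reflexive eq) (m∸n≤m p g)))

  Ok-tail : ∀ {p} b g w → Ok p ((b , g) ∷ w) → Ok g w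
  Ok-tail true  g w = proj₂
  Ok-tail false g w ok = ok

  render-injective : ∀ l g v w → Ok g v → Ok g w → render l g v ≡ render l g w → v ≡ w
  render-injective (suc l) g v w okv okw eq = render-injective l g v w okv okw (proj₂ (∷-injective eq))
  render-injective zero p [] [] _ _ _ = refl
  render-injective zero p ((a , g) ∷ v) ((b , h) ∷ w) okv okw eq with ∷-injective eq
  ... | eq₁ , eq₂ with cong State.gap eq₁
  ... | refl with low-injective a b v w okv okw (cong State.lo eq₁)
  ... | refl = cong ((a , g) ∷_)
    (render-injective (low a p g) g v w (Ok-tail a g v okv) (Ok-tail a g w okw) eq₂)

  -- Falls are forced, so only the throws carry information. Ending at height 0 means that the last
  -- fall is complete and nothing of it is lost in the word.
  parse : ∀ l g L → Linked Trans (st l g ∷ L) → State.lo (final (st l g) L) ≡ 0 →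
          ∃ λ w → Ok g w × render l g w ≡ L
  parse zero    g []      _       _  = [] , tt , refl
  parse (suc l) g (β ∷ L) (t ∷ ts) fin with Trans-fall⁻ l g β t
  ... | refl with parse l g L ts fin
  ... | w , ok , eq = w , ok , cong (st l g ∷_) eq
  parse zero    p (st l g ∷ L) (t ∷ ts) fin with parse l g L ts fin | Trans-throw⁻ p l g t
  ... | w , ok , eq | inj₁ refl = (false , g) ∷ w , ok , cong (st l g ∷_) eq
  ... | w , ok , eq | inj₂ refl =
    (true , g) ∷ w , (m≤n+m (suc g) l , ok) ,
    subst (λ k → st k g ∷ render k g w ≡ st l g ∷ L) (sym (m+n∸n≡m l (suc g))) (cong (st l g ∷_) eq)

  All-render⁻ : ∀ {P : State → Set} l g w → All P (st l g ∷ render l g w) →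
                P (st 0 g) × All (λ e → P (st 0 (gap e))) w
  All-render⁻ (suc l) g w             (_ ∷ ps) = All-render⁻ l g w ps
  All-render⁻ zero    p []            (q ∷ ps) = q , []
  All-render⁻ zero    p ((b , g) ∷ w) (q ∷ ps) with All-render⁻ (low b p g) g w ps
  ... | r , rs = q , r ∷ rs

  -- Every throw eventually falls to height 0, where the state is determined by its gap; a repeated
  -- gap would therefore repeat a state.
  Unique-render⁻ : ∀ l g w → Unique (st l g ∷ render l g w) → All (λ e → g ≢ gap e) w × Distinct w
  Unique-render⁻ (suc l) g w             (_ ∷ u) = Unique-render⁻ l g w u
  Unique-render⁻ zero    p []            _       = [] , []
  Unique-render⁻ zero    p ((b , g) ∷ w) (q ∷ u) with All-render⁻ (low b p g) g w q | Unique-render⁻ (low b p g) g w u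
  ... | r , rs | ps , d = (r ∘ cong (st 0)) ∷ All.map (_∘ cong (st 0)) rs , ps ∷ d

  nth : State → List State → ℕ → State
  nth α L       zero    = α
  nth α []      (suc i) = α
  nth α (β ∷ L) (suc i) = nth β L i

  nth-length : ∀ α L → nth α L (length L) ≡ final α L
  nth-length α []      = refl
  nth-length α (β ∷ L) = nth-length β L

  nth-Linked : ∀ {α L} → Linked Trans (α ∷ L) → ∀ {i} → i < length L → Trans (nth α L i) (nth α L (suc i))
  nth-Linked (t ∷ ts) {zero}  _         = t
  nth-Linked (t ∷ ts) {suc i} (s≤s i<) = nth-Linked ts i<

  nth-All : ∀ {P : State → Set} {α L} → All P L → ∀ {i} → i < length L → P (nth α L (suc i))
  nth-All (p ∷ ps) {zero}  _        = p
  nth-All (p ∷ ps) {suc i} (s≤s i<) = nth-All ps i<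

  nth-injective : ∀ {α L} → Unique L → ∀ {i j} → i < length L → j < length L →
                  nth α L (suc i) ≡ nth α L (suc j) → i ≡ j
  nth-injective (_ ∷ u) {zero}  {zero}  _        _        _  = refl
  nth-injective (p ∷ u) {zero}  {suc j} _        (s≤s j<) eq = ⊥-elim (nth-All p j< eq)
  nth-injective (p ∷ u) {suc i} {zero}  (s≤s i<) _        eq = ⊥-elim (nth-All p i< (sym eq))
  nth-injective (_ ∷ u) {suc i} {suc j} (s≤s i<) (s≤s j<) eq = cong suc (nth-injective u i< j< eq)

  nth-ext : ∀ {α} L M → length L ≡ length M →
            (∀ {i} → i < length L → nth α L (suc i) ≡ nth α M (suc i)) → L ≡ M
  nth-ext []      []      _  _ = refl
  nth-ext (β ∷ L) (γ ∷ M) eq h with h {0} z<s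
  ... | refl = cong (β ∷_) (nth-ext L M (suc-injective eq) (h ∘ s≤s))

  nth-applyUpTo : ∀ (f : ℕ → State) n {i} → i ≤ n → nth (f 0) (applyUpTo (f ∘ suc) n) i ≡ f i
  nth-applyUpTo f n       {zero}  _        = refl
  nth-applyUpTo f (suc n) {suc i} (s≤s i≤) = nth-applyUpTo (f ∘ suc) n i≤

  suc-% : ∀ i n .{{_ : NonZero n}} → suc i % n ≡ suc (i % n) % n
  suc-% i n = begin
    (1 + i) % n             ≡⟨ %-distribˡ-+ 1 i n ⟩
    (1 % n + i % n) % n     ≡⟨ cong (λ r → (1 % n + r) % n) (m%n%n≡m%n i n) ⟨
    (1 % n + i % n % n) % n ≡⟨ %-distribˡ-+ 1 (i % n) n ⟨
    (1 + i % n) % n         ∎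
    where open ≡-Reasoning

  -- Adding `c * m` turns the shift by `c` into one by `c * suc m`, which vanishes modulo `suc m`;
  -- no subtraction is involved.
  %-cancelʳ : ∀ i j c m → (i + c) % suc m ≡ (j + c) % suc m → i % suc m ≡ j % suc m
  %-cancelʳ i j c m eq = trans (sym (shift i)) (trans (cong (λ r → (r + (c * m) % n) % n) eq) (shift j))
    where
    n = suc m
    shift : ∀ i → ((i + c) % n + (c * m) % n) % n ≡ i % n
    shift i = begin
      ((i + c) % n + (c * m) % n) % n ≡⟨ %-distribˡ-+ (i + c) (c * m) n ⟨
      (i + c + c * m) % n             ≡⟨ cong (_% n) (+-assoc i c (c * m)) ⟩
      (i + (c + c * m)) % n           ≡⟨ cong (λ r → (i + r) % n) (*-suc c m) ⟨
      (i + c * n) % n                 ≡⟨ [m+kn]%n≡m%n i c n ⟩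
      i % n                           ∎
      where open ≡-Reasoning

  module _ {m : ℕ} (c : Cycle (suc m)) where
    open Cycle c
    private n = suc m

    periodic* : ∀ i k → s (i + k * n) ≡ s i
    periodic* i zero    = cong s (+-identityʳ i)
    periodic* i (suc k) = begin
      s (i + (n + k * n)) ≡⟨ cong s (+-assoc i n (k * n)) ⟨
      s (i + n + k * n)   ≡⟨ periodic* (i + n) k ⟩
      s (i + n)           ≡⟨ periodic i ⟩
      s i                 ∎
      where open ≡-Reasoning

    s-% : ∀ i → s i ≡ s (i % n)
    s-% i = trans (cong s (m≡m%n+[m/n]*n i n)) (periodic* (i % n) (i / n))

    s-injective : ∀ i j → s i ≡ s j → i % n ≡ j % n
    s-injective i j eq = distinct _ _ (m%n<n i n) (m%n<n j n) (trans (sym (s-% i)) (trans eq (s-% j)))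

  -- A cycle cut open just after ⟨1,1⟩. For positive `n` that state is the last entry of `states`;
  -- the copy put in front in `linked` supplies the closing link and is not counted by `unique`.
  record Loop (n : ℕ) : Set where
    field
      states   : List State
      length≡  : length states ≡ n
      linked   : Linked Trans (⟨1,1⟩ ∷ states)
      unique   : Unique states
      returns  : final ⟨1,1⟩ states ≡ ⟨1,1⟩

  module _ {m : ℕ} (ℓ : Loop (suc m)) where
    open Loop ℓ
    private
      n = suc m

      at : ℕ → State
      at i = nth ⟨1,1⟩ states i

      at-n : at n ≡ ⟨1,1⟩
      at-n = trans (cong at (sym length≡)) (trans (nth-length ⟨1,1⟩ states) returns)

      <length : ∀ {i} → i < n → i < length states
      <length = subst (_ <_) (sym length≡)

      at-step : ∀ i → Trans (at (suc (i % n))) (at (suc (suc (i % n) % n)))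
      at-step i with m≤n⇒m<n∨m≡n (m%n<n i n)
      ... | inj₁ lt = subst (λ r → Trans (at (suc (i % n))) (at (suc r))) (sym (m<n⇒m%n≡m lt))
                        (nth-Linked linked (<length lt))
      -- At the end of the list the walk is back at ⟨1,1⟩, so the first link closes the cycle.
      ... | inj₂ eq = subst₂ (λ a b → Trans a (at (suc b)))
                        (sym (trans (cong at eq) at-n)) (sym (trans (cong (_% n) eq) (n%n≡0 n)))
                        (nth-Linked linked (<length z<s))

    cycle : Cycle (suc m)
    cycle = record
      { s        = λ i → at (suc (i % n))
      ; periodic = λ i → cong (at ∘ suc) ([m+n]%n≡m%n i n)
      ; step     = λ i → subst (λ r → Trans (at (suc (i % n))) (at (suc r))) (sym (suc-% i n)) (at-step i)
      ; distinct = λ i j i<n j<n eq → subst₂ _≡_ (m<n⇒m%n≡m i<n) (m<n⇒m%n≡m j<n)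
                     (nth-injective unique (<length (m%n<n i n)) (<length (m%n<n j n)) eq)
      }

    cycle-last : Cycle.s cycle m ≡ ⟨1,1⟩
    cycle-last = trans (cong (at ∘ suc) (m<n⇒m%n≡m (n<1+n m))) at-n

    cycle11 : Cycle11 (suc m)
    cycle11 = record { cyc = cycle ; has = m , cycle-last }

  -- Both cycles have ⟨1,1⟩ at index `m`, and a cycle visits it once per period, so the rotation is
  -- by a multiple of the period.
  rotation⇒≡ : ∀ {m} (ℓ κ : Loop (suc m)) → Rotation (cycle ℓ) (cycle κ) → Loop.states ℓ ≡ Loop.states κ
  rotation⇒≡ {m} ℓ κ (k , rot) =
    nth-ext _ _ (trans (Loop.length≡ ℓ) (sym (Loop.length≡ κ)))
      λ {i} i< → let i<n = subst (i <_) (Loop.length≡ ℓ) i< in begin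
        nth ⟨1,1⟩ (Loop.states ℓ) (suc i)             ≡⟨ cong (nth ⟨1,1⟩ (Loop.states ℓ) ∘ suc) (m<n⇒m%n≡m i<n) ⟨
        Cycle.s (cycle ℓ) i                           ≡⟨ cong (nth ⟨1,1⟩ (Loop.states ℓ) ∘ suc) (shift i) ⟨
        Cycle.s (cycle ℓ) (i + k)                     ≡⟨ rot i ⟨
        Cycle.s (cycle κ) i                           ≡⟨ cong (nth ⟨1,1⟩ (Loop.states κ) ∘ suc) (m<n⇒m%n≡m i<n) ⟩
        nth ⟨1,1⟩ (Loop.states κ) (suc i)             ∎
    where
    open ≡-Reasoning
    n = suc m
    k%n≡0 : k % n ≡ 0
    k%n≡0 = %-cancelʳ k 0 m m (trans (cong (_% n) (+-comm k m)) (s-injective (cycle ℓ) (m + k) m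
      (trans (sym (rot m)) (trans (cycle-last κ) (sym (cycle-last ℓ))))))
    shift : ∀ i → (i + k) % n ≡ i % n
    shift i = begin
      (i + k) % n           ≡⟨ %-distribˡ-+ i k n ⟩
      (i % n + k % n) % n   ≡⟨ cong (λ r → (i % n + r) % n) k%n≡0 ⟩
      (i % n + 0) % n       ≡⟨ cong (_% n) (+-identityʳ (i % n)) ⟩
      i % n % n             ≡⟨ m%n%n≡m%n i n ⟩
      i % n                 ∎

  -- Every pattern through ⟨1,1⟩ is cut open just after a visit to ⟨1,1⟩.
  module _ {m : ℕ} (d : Cycle11 (suc m)) where
    open Cycle11 d
    open Cycle cyc
    private
      n  = suc m
      i₀ = proj₁ has

      t : ℕ → State
      t j = s (j + i₀)

      t-0 : t 0 ≡ ⟨1,1⟩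
      t-0 = proj₂ has

      L : List State
      L = applyUpTo (t ∘ suc) n

      nth-L : ∀ {i} → i ≤ n → nth ⟨1,1⟩ L i ≡ t i
      nth-L {i} i≤n = subst (λ α → nth α L i ≡ t i) t-0 (nth-applyUpTo t n i≤n)

    cut : Loop (suc m)
    cut = record
      { states  = L
      ; length≡ = length-applyUpTo (t ∘ suc) n
      ; linked  = subst (λ α → Linked Trans (α ∷ L)) t-0 (LinkedP.applyUpTo⁺₂ t (suc n) (λ i → step (i + i₀)))
      ; unique  = AllPairsP.applyUpTo⁺₁ (t ∘ suc) n λ {i} {j} i<j j<n eq →
          <⇒≢ i<j (subst₂ _≡_ (m<n⇒m%n≡m (<-trans i<j j<n)) (m<n⇒m%n≡m j<n)
            (%-cancelʳ i j (suc i₀) m (subst₂ (λ a b → a % n ≡ b % n)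
              (sym (+-suc i i₀)) (sym (+-suc j i₀)) (s-injective cyc (suc i + i₀) (suc j + i₀) eq))))
      ; returns = trans (sym (nth-length ⟨1,1⟩ L))
          (trans (cong (nth ⟨1,1⟩ L) (length-applyUpTo (t ∘ suc) n))
            (trans (nth-L ≤-refl) (trans (cong s (+-comm n i₀)) (trans (periodic i₀) t-0))))
      }

    cut-rotation : Rotation cyc (cycle cut)
    cut-rotation = suc i₀ , λ i → begin
      nth ⟨1,1⟩ L (suc (i % n))        ≡⟨ nth-L (m%n<n i n) ⟩
      s (suc (i % n) + i₀)             ≡⟨ cong s (+-suc (i % n) i₀) ⟨
      s (i % n + suc i₀)               ≡⟨ s-% cyc (i % n + suc i₀) ⟩
      s ((i % n + suc i₀) % n)         ≡⟨ cong s (trans (%-distribˡ-+ (i % n) (suc i₀) n)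
                                            (trans (cong (λ r → (r + suc i₀ % n) % n) (m%n%n≡m%n i n))
                                              (sym (%-distribˡ-+ i (suc i₀) n)))) ⟩
      s ((i + suc i₀) % n)             ≡⟨ s-% cyc (i + suc i₀) ⟨
      s (i + suc i₀)                   ∎
      where open ≡-Reasoning

  loop : ∀ {n} → Full n → Loop n
  loop c = record
    { states  = render 0 0 w
    ; length≡ = trans (length-render 0 0 w) (+-cancelʳ-≡ 1 (walk 0 w) _ (begin
        walk 0 w + 1                 ≡⟨ cong (λ g → walk 0 w + suc g) (lastGap-decodeFull 0 c) ⟨
        walk 0 w + suc (lastGap 0 w) ≡⟨ walk-cost w ok ⟩
        1 + cost w                   ≡⟨ cong suc (cost-decodeFull c) ⟩
        1 + _                        ≡⟨ +-comm 1 _ ⟩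
        _ + 1                        ∎))
    ; linked  = render-Linked 0 0 w ok
    ; unique  = render₀-Unique 0 w (proj₂ (decodeFull-Valid c))
    ; returns = trans (final-render 0 0 w) (cong (st 0) (lastGap-decodeFull 0 c))
    }
    where
    open ≡-Reasoning
    w = decodeFull c
    ok = proj₁ (decodeFull-Valid c)

  loop-injective : ∀ {n} (c d : Full n) → Loop.states (loop c) ≡ Loop.states (loop d) → c ≡ d
  loop-injective c d eq = decodeFull-injective c d
    (render-injective 0 0 _ _ (proj₁ (decodeFull-Valid c)) (proj₁ (decodeFull-Valid d)) eq)

  loop-surjective : ∀ n (ℓ : Loop (2 + n)) → Σ (Full (2 + n)) λ c → Loop.states (loop c) ≡ Loop.states ℓ
  loop-surjective n ℓ with parse 0 0 states linked (cong State.lo returns)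
    where open Loop ℓ
  ... | w@((b , g) ∷ w′) , ok , refl = proj₁ enc , cong (render 0 0) (proj₂ enc)
    where
    open Loop ℓ
    open ≡-Reasoning
    last≡ : lastGap 0 w ≡ 0
    last≡ = cong State.gap (trans (sym (final-render 0 0 w)) returns)
    cost≡ : cost w ≡ 2 + n
    cost≡ = suc-injective (begin
      1 + cost w                   ≡⟨ walk-cost w ok ⟨
      walk 0 w + suc (lastGap 0 w) ≡⟨ cong (λ g → walk 0 w + suc g) last≡ ⟩
      walk 0 w + 1                 ≡⟨ +-comm (walk 0 w) 1 ⟩
      1 + walk 0 w                 ≡⟨ cong suc (trans (sym (length-render 0 0 w)) length≡) ⟩
      1 + (2 + n)                  ∎)
    distinct : Distinct w
    -- The start ⟨1,1⟩ recurs as the last state, so uniqueness is available only from the state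
    -- after the first throw on.
    distinct with Unique-render⁻ (low b 0 g) g w′ unique
    ... | ps , d = ps ∷ d
    enc : EncodingFull (2 + n) w
    enc = encodeFull (2 + n) w (s≤s (s≤s z≤n)) (ok , distinct) last≡ cost≡
  ... | [] , ok , eq with trans (cong length eq) (Loop.length≡ ℓ)
  ... | ()

-- From bijections to the recursion for A and the formula for B

module Counting where

  open import Data.Nat
  open import Data.Nat.DivMod using (_%_)
  open import Data.Nat.Induction using (<-rec)
  open import Data.Nat.Properties
  open import Data.Fin using (Fin; zero; suc; toℕ)
  open import Data.Fin.Permutation using (↔⇒≡)
  open import Data.Fin.Properties using (+↔⊎; *↔×)
  open import Data.Product using (Σ; ∃; _×_; _,_; proj₁; proj₂)
  open import Data.Product.Function.NonDependent.Propositional using (_×-↔_)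
  open import Data.Sum using (_⊎_; inj₁; inj₂)
  open import Data.Sum.Function.Propositional using (_⊎-↔_)
  open import Function using (_∘_)
  open import Function.Bundles using (_↔_; mk↔ₛ′; module Equivalence)
  open import Function.Construct.Composition using (_↔-∘_)
  open import Function.Construct.Symmetry using (↔-sym)
  open import Function.Construct.Identity using (↔-id)
  open import Relation.Binary.PropositionalEquality
  open Words
  open Loops

  Step : ℕ → ℕ → Set
  Step m n = (Fin (2 + m) × Code (suc m) (n ∸ m)) ⊎ (Fin (1 + m) × Code m (n ∸ m))

  Code↔Step : ∀ {m n} → Code (suc m) (suc n) ↔ Step m n
  Code↔Step = mk↔ₛ′ to from (λ { (inj₁ _) → refl ; (inj₂ _) → refl }) (λ { (keep _ _) → refl ; (new _ _) → refl })
    where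
    to : ∀ {m n} → Code (suc m) (suc n) → Step m n
    to (keep i c) = inj₁ (i , c)
    to (new i c)  = inj₂ (i , c)
    from : ∀ {m n} → Step m n → Code (suc m) (suc n)
    from (inj₁ (i , c)) = keep i c
    from (inj₂ (i , c)) = new i c

  Fin-Step : ∀ {m n a b} → Code (suc m) (n ∸ m) ↔ Fin a → Code m (n ∸ m) ↔ Fin b →
             Code (suc m) (suc n) ↔ Fin ((2 + m) * a + (1 + m) * b)
  Fin-Step {m} {n} {a} {b} f g =
    ↔-sym +↔⊎ ↔-∘ (((↔-sym *↔× ↔-∘ (↔-id (Fin (2 + m)) ×-↔ f)) ⊎-↔ (↔-sym *↔× ↔-∘ (↔-id (Fin (1 + m)) ×-↔ g))) ↔-∘ Code↔Step)

  -- Kept abstract because unfolding the well-founded recursion is slow.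
  abstract
    finite : ∀ n m → ∃ λ a → Code m n ↔ Fin a
    finite = <-rec _ go
      where
      go : ∀ n → (∀ {k} → k < n → ∀ m → ∃ λ a → Code m k ↔ Fin a) → ∀ m → ∃ λ a → Code m n ↔ Fin a
      go zero    rec zero    = 1 , mk↔ₛ′ (λ _ → zero) (λ _ → nil) (λ { zero → refl }) (λ { nil → refl })
      go zero    rec (suc m) = 0 , mk↔ₛ′ (λ ()) (λ ()) (λ ()) (λ ())
      go (suc n) rec zero    = 0 , mk↔ₛ′ (λ ()) (λ ()) (λ ()) (λ ())
      go (suc n) rec (suc m) = _ ,
        Fin-Step (proj₂ (rec (s≤s (m∸n≤m n m)) (suc m))) (proj₂ (rec (s≤s (m∸n≤m n m)) m))

  A : ℕ → ℕ → ℕ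
  A m n = proj₁ (finite n m)

  Code↔Fin : ∀ m n → Code m n ↔ Fin (A m n)
  Code↔Fin m n = proj₂ (finite n m)

  abstract
    A-zero-zero : A 0 0 ≡ 1
    A-zero-zero = refl

    A-suc-zero : ∀ m → A (suc m) 0 ≡ 0
    A-suc-zero m = refl

    A-zero-suc : ∀ n → A 0 (suc n) ≡ 0
    A-zero-suc n = refl

  -- Two bijections of one type with `Fin` have equal sizes, so the recursion follows without
  -- unfolding the abstract `finite`.
  A-suc : ∀ m n → A (suc m) (suc n) ≡ (2 + m) * A (suc m) (n ∸ m) + (1 + m) * A m (n ∸ m)
  A-suc m n = ↔⇒≡ (Fin-Step (Code↔Fin (suc m) (n ∸ m)) (Code↔Fin m (n ∸ m)) ↔-∘ ↔-sym (Code↔Fin (suc m) (suc n)))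

  ∑ : ℕ → (ℕ → ℕ) → ℕ
  ∑ zero    f = 0
  ∑ (suc k) f = f 0 + ∑ k (f ∘ suc)

  -- `∑` unrolls at the front, as a dependent sum over `Fin` does, whereas the rational partial sums
  -- grow at the back.
  ∑-last : ∀ k f → ∑ (suc k) f ≡ ∑ k f + f k
  ∑-last zero    f = +-comm (f 0) 0
  ∑-last (suc k) f = trans (cong (f 0 +_) (∑-last k (f ∘ suc))) (sym (+-assoc (f 0) _ _))

  Σ↔Fin : ∀ k {T : ℕ → Set} (f : ℕ → ℕ) → (∀ i → T i ↔ Fin (f i)) → (Σ (Fin k) (T ∘ toℕ)) ↔ Fin (∑ k f)
  Σ↔Fin zero    f h = mk↔ₛ′ (λ ()) (λ ()) (λ ()) (λ ())
  Σ↔Fin (suc k) {T} f h = ↔-sym +↔⊎ ↔-∘ ((h 0 ⊎-↔ Σ↔Fin k (f ∘ suc) (h ∘ suc)) ↔-∘ split)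
    where
    split : Σ (Fin (suc k)) (T ∘ toℕ) ↔ (T 0 ⊎ Σ (Fin k) (T ∘ suc ∘ toℕ))
    split = mk↔ₛ′
      (λ { (zero , x) → inj₁ x ; (suc i , x) → inj₂ (i , x) })
      (λ { (inj₁ x) → zero , x ; (inj₂ (i , x)) → suc i , x })
      (λ { (inj₁ _) → refl ; (inj₂ _) → refl })
      (λ { (zero , _) → refl ; (suc _ , _) → refl })

  term : ℕ → ℕ → ℕ
  term n m = A (suc m) (n ∸ suc m) + A (suc m) (n ∸ (2 + m))

  Full↔Fin : ∀ n → Full n ↔ Fin (∑ n (term n))
  Full↔Fin n = Σ↔Fin n (term n) λ m → ↔-sym +↔⊎ ↔-∘ (Code↔Fin (suc m) (n ∸ suc m) ⊎-↔ Code↔Fin (suc m) (n ∸ (2 + m)))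

  bijective⇒≡ : ∀ {T : Set} {N k} → T ↔ Fin N → (g : T → Fin k) →
                (∀ x y → g x ≡ g y → x ≡ y) → (∀ y → ∃ λ x → g x ≡ y) → k ≡ N
  bijective⇒≡ e g inj sur = ↔⇒≡ (e ↔-∘ ↔-sym
    (mk↔ₛ′ g (proj₁ ∘ sur) (proj₂ ∘ sur) (λ x → inj _ _ (proj₂ (sur (g x))))))

  -- Every rotation class contains `cycle (loop c)` for exactly one `c`: cutting a cycle yields one,
  -- and `rotation⇒≡` excludes a second. So any admissible `f` restricts to a bijection from
  -- `Full n`.
  count : ∀ {n k} → 2 ≤ n → CountIs n k → k ≡ ∑ n (term n)
  count {suc zero} (s≤s ())
  count {suc (suc n)} {k} _ (f , surjective , fibres) =
    bijective⇒≡ (Full↔Fin (2 + n)) class class-injective class-surjective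
    where
    class : Full (2 + n) → Fin k
    class c = f (cycle11 (loop c))

    class-injective : ∀ c d → class c ≡ class d → c ≡ d
    class-injective c d eq = loop-injective c d
      (rotation⇒≡ (loop c) (loop d) (Equivalence.to (fibres (cycle11 (loop c)) (cycle11 (loop d))) eq))

    class-surjective : ∀ y → ∃ λ c → class c ≡ y
    class-surjective y with surjective y
    ... | d , fd≡y with loop-surjective n (cut d)
    ... | c , eq = c , trans (sym (Equivalence.from (fibres d (cycle11 (loop c))) rot)) (fd≡y refl)
      where
      rot : Rotation (Cycle11.cyc d) (cycle (loop c))
      rot = proj₁ (cut-rotation d) , λ i →
        trans (cong (λ L → nth ⟨1,1⟩ L (suc (i % (2 + n)))) eq) (proj₂ (cut-rotation d) i)

-- Rational estimates and powers of 1/2 and 3/4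

module Rationals where

  open import Data.Nat as ℕ using (ℕ; zero; suc)
  import Data.Nat.Properties as ℕ
  open import Data.Integer as ℤ using (+_)
  import Data.Integer.Properties as ℤ
  open import Data.Rational
  open import Data.Rational.Properties
  open import Data.Rational.Solver using (module +-*-Solver)
  import Data.Rational.Unnormalised as ℚᵘ
  import Data.Rational.Unnormalised.Properties as ℚᵘ
  open import Data.Product using (∃; _,_)
  open import Data.Sum using (inj₁; inj₂)
  open import Relation.Binary.PropositionalEquality
  open +-*-Solver

  ι : ℕ → ℚ
  ι n = + n / 1

  toℚᵘ-ι : ∀ n → toℚᵘ (ι n) ℚᵘ.≃ ℚᵘ.mkℚᵘ (+ n) 0
  toℚᵘ-ι n = toℚᵘ-fromℚᵘ (ℚᵘ.mkℚᵘ (+ n) 0)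

  ι-+ : ∀ m n → ι (m ℕ.+ n) ≡ ι m + ι n
  ι-+ m n = toℚᵘ-injective (begin
    toℚᵘ (ι (m ℕ.+ n))                          ≈⟨ toℚᵘ-ι (m ℕ.+ n) ⟩
    ℚᵘ.mkℚᵘ (+ (m ℕ.+ n)) 0                     ≈⟨ ℚᵘ.*≡* (cong (ℤ._* + 1) (sym (cong₂ ℤ._+_ (ℤ.*-identityʳ (+ m)) (ℤ.*-identityʳ (+ n))))) ⟩
    ℚᵘ.mkℚᵘ (+ m) 0 ℚᵘ.+ ℚᵘ.mkℚᵘ (+ n) 0        ≈⟨ ℚᵘ.+-cong (toℚᵘ-ι m) (toℚᵘ-ι n) ⟨
    toℚᵘ (ι m) ℚᵘ.+ toℚᵘ (ι n)                  ≈⟨ toℚᵘ-homo-+ (ι m) (ι n) ⟨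
    toℚᵘ (ι m + ι n)                            ∎)
    where open ℚᵘ.≃-Reasoning

  ι-* : ∀ m n → ι (m ℕ.* n) ≡ ι m * ι n
  ι-* m n = toℚᵘ-injective (begin
    toℚᵘ (ι (m ℕ.* n))                          ≈⟨ toℚᵘ-ι (m ℕ.* n) ⟩
    ℚᵘ.mkℚᵘ (+ (m ℕ.* n)) 0                     ≈⟨ ℚᵘ.*≡* (cong (ℤ._* + 1) (ℤ.pos-* m n)) ⟩
    ℚᵘ.mkℚᵘ (+ m) 0 ℚᵘ.* ℚᵘ.mkℚᵘ (+ n) 0        ≈⟨ ℚᵘ.*-cong (toℚᵘ-ι m) (toℚᵘ-ι n) ⟨
    toℚᵘ (ι m) ℚᵘ.* toℚᵘ (ι n)                  ≈⟨ toℚᵘ-homo-* (ι m) (ι n) ⟨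
    toℚᵘ (ι m * ι n)                            ∎)
    where open ℚᵘ.≃-Reasoning

  ι-nonNeg : ∀ n → 0ℚ ≤ ι n
  ι-nonNeg n = nonNegative⁻¹ (ι n) {{normalize-nonNeg n 1}}

  ι-mono : ∀ {m n} → m ℕ.≤ n → ι m ≤ ι n
  ι-mono {m} {n} m≤n = begin
    ι m                   ≡⟨ +-identityʳ (ι m) ⟨
    ι m + 0ℚ              ≤⟨ +-monoʳ-≤ (ι m) (ι-nonNeg (n ℕ.∸ m)) ⟩
    ι m + ι (n ℕ.∸ m)     ≡⟨ ι-+ m (n ℕ.∸ m) ⟨
    ι (m ℕ.+ (n ℕ.∸ m))   ≡⟨ cong ι (ℕ.m+[n∸m]≡n m≤n) ⟩
    ι n                   ∎
    where open ≤-Reasoning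

  /-*-ι : ∀ m d → (+ m / suc d) * ι (suc d) ≡ ι m
  /-*-ι m d = toℚᵘ-injective (begin
    toℚᵘ ((+ m / suc d) * ι (suc d))              ≈⟨ toℚᵘ-homo-* (+ m / suc d) (ι (suc d)) ⟩
    toℚᵘ (+ m / suc d) ℚᵘ.* toℚᵘ (ι (suc d))      ≈⟨ ℚᵘ.*-cong (toℚᵘ-fromℚᵘ (ℚᵘ.mkℚᵘ (+ m) d)) (toℚᵘ-ι (suc d)) ⟩
    ℚᵘ.mkℚᵘ (+ m) d ℚᵘ.* ℚᵘ.mkℚᵘ (+ suc d) 0      ≈⟨ ℚᵘ.*≡* (trans (ℤ.*-identityʳ _) (cong (λ k → + m ℤ.* + suc k) (sym (ℕ.*-identityʳ d)))) ⟩
    ℚᵘ.mkℚᵘ (+ m) 0                               ≈⟨ toℚᵘ-ι m ⟨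
    toℚᵘ (ι m)                                    ∎)
    where open ℚᵘ.≃-Reasoning

  *-monoˡ : ∀ {r p q} → 0ℚ ≤ r → p ≤ q → r * p ≤ r * q
  *-monoˡ {r} 0≤r = *-monoˡ-≤-nonNeg r {{nonNegative 0≤r}}

  *-monoʳ : ∀ {r p q} → 0ℚ ≤ r → p ≤ q → p * r ≤ q * r
  *-monoʳ {r} 0≤r = *-monoʳ-≤-nonNeg r {{nonNegative 0≤r}}

  *-nonNeg : ∀ {p q} → 0ℚ ≤ p → 0ℚ ≤ q → 0ℚ ≤ p * q
  *-nonNeg {p} {q} 0≤p 0≤q = subst (_≤ p * q) (*-zeroʳ p) (*-monoˡ 0≤p 0≤q)

  +-nonNeg : ∀ {p q} → 0ℚ ≤ p → 0ℚ ≤ q → 0ℚ ≤ p + q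
  +-nonNeg 0≤p 0≤q = +-mono-≤ 0≤p 0≤q

  p≤q+p : ∀ {p q} → 0ℚ ≤ q → p ≤ q + p
  p≤q+p {p} {q} 0≤q = subst (_≤ q + p) (+-identityˡ p) (+-monoˡ-≤ p 0≤q)

  ∣∣-≤ : ∀ {x b} → x ≤ b → - x ≤ b → ∣ x ∣ ≤ b
  ∣∣-≤ {x} x≤b -x≤b with ∣p∣≡p∨∣p∣≡-p x
  ... | inj₁ eq = subst (_≤ _) (sym eq) x≤b
  ... | inj₂ eq = subst (_≤ _) (sym eq) -x≤b

  ∣-∣-≤ : ∀ {x y b} → x ≤ b + y → y ≤ b + x → ∣ x - y ∣ ≤ b
  ∣-∣-≤ {x} {y} {b} x≤ y≤ = ∣∣-≤
    (subst (x - y ≤_) (solve 2 (λ b y → (b :+ y) :- y := b) refl b y) (+-monoˡ-≤ (- y) x≤))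
    (subst₂ _≤_ (solve 2 (λ x y → y :- x := :- (x :- y)) refl x y)
                (solve 2 (λ b x → (b :+ x) :- x := b) refl b x) (+-monoˡ-≤ (- x) y≤))

  ∣-∣-bounded : ∀ {x y b} → 0ℚ ≤ x → x ≤ b → 0ℚ ≤ y → y ≤ b → ∣ x - y ∣ ≤ b
  ∣-∣-bounded {b = b} 0≤x x≤b 0≤y y≤b = ∣-∣-≤
    (≤-trans x≤b (subst (_≤ b + _) (+-identityʳ b) (+-monoʳ-≤ b 0≤y)))
    (≤-trans y≤b (subst (_≤ b + _) (+-identityʳ b) (+-monoʳ-≤ b 0≤x)))

  ∣+∣-mono : ∀ {x y X Y} → ∣ x ∣ ≤ X → ∣ y ∣ ≤ Y → ∣ x + y ∣ ≤ X + Y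
  ∣+∣-mono {x} {y} hx hy = ≤-trans (∣p+q∣≤∣p∣+∣q∣ x y) (+-mono-≤ hx hy)

  ∣*∣-mono : ∀ {c x X} → 0ℚ ≤ c → ∣ x ∣ ≤ X → ∣ c * x ∣ ≤ c * X
  ∣*∣-mono {c} {x} {X} 0≤c hx = subst (_≤ c * X)
    (sym (trans (∣p*q∣≡∣p∣*∣q∣ c x) (cong (_* ∣ x ∣) (0≤p⇒∣p∣≡p 0≤c)))) (*-monoˡ 0≤c hx)

  half^-+ : ∀ m n → half^ (m ℕ.+ n) ≡ half^ m * half^ n
  half^-+ zero    n = sym (*-identityˡ (half^ n))
  half^-+ (suc m) n = trans (cong (½ *_) (half^-+ m n)) (sym (*-assoc ½ (half^ m) (half^ n)))

  0≤½ : 0ℚ ≤ ½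
  0≤½ = nonNegative⁻¹ ½

  half^-nonNeg : ∀ n → 0ℚ ≤ half^ n
  half^-nonNeg zero    = nonNegative⁻¹ 1ℚ
  half^-nonNeg (suc n) = *-nonNeg 0≤½ (half^-nonNeg n)

  half^-2^ : ∀ n → half^ n * ι (2 ℕ.^ n) ≡ 1ℚ
  half^-2^ zero    = refl
  half^-2^ (suc n) = begin
    ½ * half^ n * ι (2 ℕ.* 2 ℕ.^ n)      ≡⟨ cong (½ * half^ n *_) (ι-* 2 (2 ℕ.^ n)) ⟩
    ½ * half^ n * (ι 2 * ι (2 ℕ.^ n))    ≡⟨ solve 2 (λ h w → con ½ :* h :* (con (ι 2) :* w) := h :* w) refl (half^ n) (ι (2 ℕ.^ n)) ⟩
    half^ n * ι (2 ℕ.^ n)                ≡⟨ half^-2^ n ⟩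
    1ℚ                                   ∎
    where open ≡-Reasoning

  ¾ : ℚ
  ¾ = + 3 / 4

  ¾^ : ℕ → ℚ
  ¾^ zero    = 1ℚ
  ¾^ (suc j) = ¾ * ¾^ j

  0≤¾ : 0ℚ ≤ ¾
  0≤¾ = nonNegative⁻¹ ¾

  ¾^-nonNeg : ∀ j → 0ℚ ≤ ¾^ j
  ¾^-nonNeg zero    = nonNegative⁻¹ 1ℚ
  ¾^-nonNeg (suc j) = *-nonNeg 0≤¾ (¾^-nonNeg j)

  -- Bernoulli's inequality (4/3)^j ≥ 1 + j/3, cleared of denominators.
  ¾^-bound : ∀ j → ¾^ j * ι (3 ℕ.+ j) ≤ ι 3
  ¾^-bound zero    = ≤-refl
  ¾^-bound (suc j) = begin
    ¾ * ¾^ j * ι (4 ℕ.+ j)                ≤⟨ p≤q+p (*-nonNeg (nonNegative⁻¹ (+ 1 / 4)) (*-nonNeg (¾^-nonNeg j) (ι-nonNeg j))) ⟩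
    (+ 1 / 4) * (¾^ j * ι j) + ¾ * ¾^ j * ι (4 ℕ.+ j)
      ≡⟨ cong (λ z → (+ 1 / 4) * (¾^ j * ι j) + ¾ * ¾^ j * z) (ι-+ 4 j) ⟩
    (+ 1 / 4) * (¾^ j * ι j) + ¾ * ¾^ j * (ι 4 + ι j)
      ≡⟨ solve 2 (λ r x → con (+ 1 / 4) :* (r :* x) :+ con ¾ :* r :* (con (ι 4) :+ x) := r :* (con (ι 3) :+ x)) refl (¾^ j) (ι j) ⟩
    ¾^ j * (ι 3 + ι j)                    ≡⟨ cong (¾^ j *_) (ι-+ 3 j) ⟨
    ¾^ j * ι (3 ℕ.+ j)                    ≤⟨ ¾^-bound j ⟩
    ι 3                                   ∎
    where open ≤-Reasoning

  -- The denominator of `ε` serves: the product is the numerator, a positive integer.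
  archimedean : ∀ ε → 0ℚ < ε → ∃ λ d → 1ℚ ≤ ε * ι d
  archimedean ε@(mkℚ (+ zero) d _) (*<* (ℤ.+<+ ()))
  archimedean ε@(mkℚ (+ suc n) d _) _ = suc d , (begin
    1ℚ                          ≤⟨ ι-mono {1} {suc n} (ℕ.s≤s ℕ.z≤n) ⟩
    ι (suc n)                   ≡⟨ /-*-ι (suc n) d ⟨
    (+ suc n / suc d) * ι (suc d) ≡⟨ cong (_* ι (suc d)) (↥p/↧p≡p ε) ⟩
    ε * ι (suc d)               ∎)
    where open ≤-Reasoning
  archimedean (mkℚ (ℤ.-[1+ n ]) d _) (*<* ())

-- Convergence for a fixed number of blocks

module Asymptotics where

  open import Data.Nat as ℕ using (ℕ; zero; suc; _∸_; _^_; z≤n; s≤s)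
  import Data.Nat.Properties as ℕ
  open import Data.Nat.Induction using (<-rec)
  open import Data.Integer using (+_)
  open import Data.Rational
  open import Data.Rational.Properties
  open import Data.Rational.Solver using (module +-*-Solver)
  open import Data.Product using (_×_; _,_; proj₁; proj₂)
  open import Data.Sum using (inj₁; inj₂)
  open import Relation.Binary.PropositionalEquality
  open +-*-Solver
  open Counting
  open Rationals

  -- The index m of p, E, b, G and c stands for m + 1 blocks: p m n tends to E m as n → ∞, and
  -- both satisfy the recursion given by mix.
  p : ℕ → ℕ → ℚ
  p m n = ι (A (suc m) n) * half^ n

  E : ℕ → ℚ
  E m = ι (suc m) * q (suc m)

  weight : ℕ → ℚ
  weight m = half^ (suc m) * ι (2 ℕ.+ m)

  mix : ℕ → ℚ → ℚ → ℚ
  mix m x y = half^ (2 ℕ.+ m) * (ι (3 ℕ.+ m) * x + ι (2 ℕ.+ m) * y)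

  A-suc-+ : ∀ m k → A (suc m) (suc m ℕ.+ k) ≡ (2 ℕ.+ m) ℕ.* A (suc m) k ℕ.+ (1 ℕ.+ m) ℕ.* A m k
  A-suc-+ m k = trans (A-suc m (m ℕ.+ k))
    (cong (λ j → (2 ℕ.+ m) ℕ.* A (suc m) j ℕ.+ (1 ℕ.+ m) ℕ.* A m j) (ℕ.m+n∸m≡n m k))

  A-small : ∀ m n → n ℕ.≤ m → A (suc m) n ≡ 0
  A-small m zero _ = A-suc-zero m
  A-small (suc m) (suc n) (s≤s n≤m) = begin
    A (2 ℕ.+ m) (suc n)                   ≡⟨ A-suc (suc m) n ⟩
    step (n ∸ suc m)                      ≡⟨ cong step (ℕ.m≤n⇒m∸n≡0 (ℕ.m≤n⇒m≤1+n n≤m)) ⟩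
    step 0                                ≡⟨ cong₂ (λ a b → (3 ℕ.+ m) ℕ.* a ℕ.+ (2 ℕ.+ m) ℕ.* b) (A-suc-zero (suc m)) (A-suc-zero m) ⟩
    (3 ℕ.+ m) ℕ.* 0 ℕ.+ (2 ℕ.+ m) ℕ.* 0   ≡⟨ cong₂ ℕ._+_ (ℕ.*-zeroʳ m) (ℕ.*-zeroʳ m) ⟩
    0                                     ∎
    where
    open ≡-Reasoning
    step : ℕ → ℕ
    step j = (3 ℕ.+ m) ℕ.* A (2 ℕ.+ m) j ℕ.+ (2 ℕ.+ m) ℕ.* A (suc m) j

  p-suc : ∀ m k → p (suc m) (2 ℕ.+ m ℕ.+ k) ≡ mix m (p (suc m) k) (p m k)
  p-suc m k = begin
    ι (A (2 ℕ.+ m) (2 ℕ.+ m ℕ.+ k)) * half^ (2 ℕ.+ m ℕ.+ k)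
      ≡⟨ cong₂ _*_ (cong ι (A-suc-+ (suc m) k)) (half^-+ (2 ℕ.+ m) k) ⟩
    ι ((3 ℕ.+ m) ℕ.* a ℕ.+ (2 ℕ.+ m) ℕ.* b) * (h * half^ k)
      ≡⟨ cong (_* (h * half^ k)) (trans (ι-+ ((3 ℕ.+ m) ℕ.* a) ((2 ℕ.+ m) ℕ.* b)) (cong₂ _+_ (ι-* (3 ℕ.+ m) a) (ι-* (2 ℕ.+ m) b))) ⟩
    (ι (3 ℕ.+ m) * ι a + ι (2 ℕ.+ m) * ι b) * (h * half^ k)
      ≡⟨ solve 6 (λ c d x y h k → (c :* x :+ d :* y) :* (h :* k) := h :* (c :* (x :* k) :+ d :* (y :* k)))
           refl (ι (3 ℕ.+ m)) (ι (2 ℕ.+ m)) (ι a) (ι b) h (half^ k) ⟩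
    mix m (p (suc m) k) (p m k) ∎
    where
    open ≡-Reasoning
    a = A (2 ℕ.+ m) k
    b = A (suc m) k
    h = half^ (2 ℕ.+ m)

  p-small : ∀ m n → n ℕ.≤ m → p m n ≡ 0ℚ
  p-small m n n≤m = trans (cong (λ a → ι a * half^ n) (A-small m n n≤m)) (*-zeroˡ (half^ n))

  -- A single block of cost n is a set of distances with maximum n, and there are 2ⁿ⁻¹ of these.
  p₀ : ∀ n → p 0 (suc n) ≡ ½
  p₀ zero    = cong (λ a → ι a * half^ 1) (trans (A-suc 0 0) (cong₂ (λ a b → 2 ℕ.* a ℕ.+ 1 ℕ.* b) (A-suc-zero 0) A-zero-zero))
  p₀ (suc n) = begin
    ι (A 1 (2 ℕ.+ n)) * half^ (2 ℕ.+ n)     ≡⟨ cong (λ a → ι a * half^ (2 ℕ.+ n)) (trans (A-suc-+ 0 (suc n)) (cong (λ a → 2 ℕ.* A 1 (suc n) ℕ.+ 1 ℕ.* a) (A-zero-suc n))) ⟩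
    ι (2 ℕ.* A 1 (suc n) ℕ.+ 0) * (½ * half^ (suc n)) ≡⟨ cong (λ a → ι a * (½ * half^ (suc n))) (ℕ.+-identityʳ (2 ℕ.* A 1 (suc n))) ⟩
    ι (2 ℕ.* A 1 (suc n)) * (½ * half^ (suc n)) ≡⟨ cong (_* (½ * half^ (suc n))) (ι-* 2 (A 1 (suc n))) ⟩
    ι 2 * ι (A 1 (suc n)) * (½ * half^ (suc n)) ≡⟨ solve 2 (λ a h → con (ι 2) :* a :* (con ½ :* h) := a :* h) refl (ι (A 1 (suc n))) (half^ (suc n)) ⟩
    p 0 (suc n)                              ≡⟨ p₀ n ⟩
    ½                                        ∎
    where open ≡-Reasoning

  mix-nonNeg : ∀ m {x y} → 0ℚ ≤ x → 0ℚ ≤ y → 0ℚ ≤ mix m x y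
  mix-nonNeg m 0≤x 0≤y = *-nonNeg (half^-nonNeg (2 ℕ.+ m))
    (+-nonNeg (*-nonNeg (ι-nonNeg (3 ℕ.+ m)) 0≤x) (*-nonNeg (ι-nonNeg (2 ℕ.+ m)) 0≤y))

  mix-mono : ∀ m {x y X Y} → x ≤ X → y ≤ Y → mix m x y ≤ mix m X Y
  mix-mono m x≤X y≤Y = *-monoˡ (half^-nonNeg (2 ℕ.+ m))
    (+-mono-≤ (*-monoˡ (ι-nonNeg (3 ℕ.+ m)) x≤X) (*-monoˡ (ι-nonNeg (2 ℕ.+ m)) y≤Y))

  mix-∣-∣ : ∀ m x y x′ y′ → ∣ mix m x y - mix m x′ y′ ∣ ≤ mix m ∣ x - x′ ∣ ∣ y - y′ ∣
  mix-∣-∣ m x y x′ y′ = subst (λ z → ∣ z ∣ ≤ mix m ∣ x - x′ ∣ ∣ y - y′ ∣)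
    (solve 7 (λ h c d x y x′ y′ → h :* (c :* (x :- x′) :+ d :* (y :- y′)) :=
                h :* (c :* x :+ d :* y) :- h :* (c :* x′ :+ d :* y′))
       refl (half^ (2 ℕ.+ m)) (ι (3 ℕ.+ m)) (ι (2 ℕ.+ m)) x y x′ y′)
    (∣*∣-mono (half^-nonNeg (2 ℕ.+ m))
      (∣+∣-mono (∣*∣-mono (ι-nonNeg (3 ℕ.+ m)) ≤-refl) (∣*∣-mono (ι-nonNeg (2 ℕ.+ m)) ≤-refl)))

  -- Since (m + 3) + (m + 1) = 2 (m + 2), a bound proportional to the number of blocks keeps its
  -- shape. With `δ` = 1/2 this gives the domination, with a geometrically decreasing `δ` the error
  -- estimate.
  mix-linear : ∀ m δ → mix m (ι (2 ℕ.+ m) * δ) (ι (1 ℕ.+ m) * δ) ≡ weight m * (ι (2 ℕ.+ m) * δ)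
  mix-linear m δ = begin
    ½ * (½ * h) * (ι (3 ℕ.+ m) * (ι (2 ℕ.+ m) * δ) + ι (2 ℕ.+ m) * (ι (1 ℕ.+ m) * δ))
      ≡⟨ cong₂ (λ u v → ½ * (½ * h) * (u * (ι (2 ℕ.+ m) * δ) + ι (2 ℕ.+ m) * (v * δ))) (ι-+ 3 m) (ι-+ 1 m) ⟩
    ½ * (½ * h) * ((ι 3 + ι m) * (ι (2 ℕ.+ m) * δ) + ι (2 ℕ.+ m) * ((ι 1 + ι m) * δ))
      ≡⟨ solve 4 (λ h x y δ → con ½ :* (con ½ :* h) :* ((con (ι 3) :+ x) :* (y :* δ) :+ y :* ((con (ι 1) :+ x) :* δ))
                   := con ½ :* h :* (con (ι 2) :+ x) :* (y :* δ)) refl h (ι m) (ι (2 ℕ.+ m)) δ ⟩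
    ½ * h * (ι 2 + ι m) * (ι (2 ℕ.+ m) * δ)
      ≡⟨ cong (λ u → ½ * h * u * (ι (2 ℕ.+ m) * δ)) (ι-+ 2 m) ⟨
    weight m * (ι (2 ℕ.+ m) * δ) ∎
    where
    open ≡-Reasoning
    h = half^ m

  weight-suc : ∀ m → weight (suc m) ≤ weight m
  weight-suc m = begin
    ½ * (½ * h) * ι (3 ℕ.+ m)
      ≤⟨ p≤q+p (*-nonNeg (*-nonNeg (*-nonNeg 0≤½ 0≤½) (half^-nonNeg m)) (ι-nonNeg (1 ℕ.+ m))) ⟩
    ½ * ½ * h * ι (1 ℕ.+ m) + ½ * (½ * h) * ι (3 ℕ.+ m)
      ≡⟨ cong₂ (λ u v → ½ * ½ * h * u + ½ * (½ * h) * v) (ι-+ 1 m) (ι-+ 3 m) ⟩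
    ½ * ½ * h * (ι 1 + ι m) + ½ * (½ * h) * (ι 3 + ι m)
      ≡⟨ solve 2 (λ h x → con ½ :* con ½ :* h :* (con (ι 1) :+ x) :+ con ½ :* (con ½ :* h) :* (con (ι 3) :+ x)
                   := con ½ :* h :* (con (ι 2) :+ x)) refl h (ι m) ⟩
    ½ * h * (ι 2 + ι m)   ≡⟨ cong (½ * h *_) (ι-+ 2 m) ⟨
    weight m              ∎
    where
    open ≤-Reasoning
    h = half^ m

  weight≤1 : ∀ m → weight m ≤ 1ℚ
  weight≤1 zero    = ≤-refl
  weight≤1 (suc m) = ≤-trans (weight-suc m) (weight≤1 m)

  weight≤¾ : ∀ m → weight (suc m) ≤ ¾
  weight≤¾ zero    = ≤-refl
  weight≤¾ (suc m) = ≤-trans (weight-suc (suc m)) (weight≤¾ m)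

  p-bounds : ∀ n m → 0ℚ ≤ p m n × p m n ≤ ι (suc m) * ½
  p-bounds = <-rec _ go
    where
    go : ∀ n → (∀ {k} → k ℕ.< n → ∀ m → 0ℚ ≤ p m k × p m k ≤ ι (suc m) * ½) →
         ∀ m → 0ℚ ≤ p m n × p m n ≤ ι (suc m) * ½
    go zero    rec zero rewrite p-small 0 0 z≤n = ≤-refl , 0≤½
    go (suc n) rec zero rewrite p₀ n = 0≤½ , ≤-refl
    go n rec (suc m) with ℕ.≤-total n (suc m)
    ... | inj₁ n≤1+m rewrite p-small (suc m) n n≤1+m = ≤-refl , *-nonNeg (ι-nonNeg (2 ℕ.+ m)) 0≤½
    ... | inj₂ 1+m≤n with ℕ.m≤n⇒m<n∨m≡n 1+m≤n
    ... | inj₂ refl rewrite p-small (suc m) (suc m) ℕ.≤-refl = ≤-refl , *-nonNeg (ι-nonNeg (2 ℕ.+ m)) 0≤½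
    ... | inj₁ 2+m≤n = subst (λ n → 0ℚ ≤ p (suc m) n × p (suc m) n ≤ ι (2 ℕ.+ m) * ½) (ℕ.m+[n∸m]≡n 2+m≤n)
      ( subst (0ℚ ≤_) (sym (p-suc m k)) (mix-nonNeg m (proj₁ (rec k<n (suc m))) (proj₁ (rec k<n m)))
      , (begin
        p (suc m) (2 ℕ.+ m ℕ.+ k)                           ≡⟨ p-suc m k ⟩
        mix m (p (suc m) k) (p m k)                         ≤⟨ mix-mono m (proj₂ (rec k<n (suc m))) (proj₂ (rec k<n m)) ⟩
        mix m (ι (2 ℕ.+ m) * ½) (ι (1 ℕ.+ m) * ½)           ≡⟨ mix-linear m ½ ⟩
        weight m * (ι (2 ℕ.+ m) * ½)                        ≤⟨ *-monoʳ (*-nonNeg (ι-nonNeg (2 ℕ.+ m)) 0≤½) (weight≤1 m) ⟩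
        1ℚ * (ι (2 ℕ.+ m) * ½)                              ≡⟨ *-identityˡ (ι (2 ℕ.+ m) * ½) ⟩
        ι (2 ℕ.+ m) * ½                                     ∎))
      where
      open ≤-Reasoning
      k = n ∸ (2 ℕ.+ m)
      k<n : k ℕ.< n
      k<n = ℕ.∸-monoʳ-< {m = n} {n = 2 ℕ.+ m} {o = 0} (s≤s z≤n) 2+m≤n

  denominator : ℕ → ℕ
  denominator k = suc (2 ^ (k ℕ.+ 2) ∸ (k ℕ.+ 2) ∸ 2)

  -- For i = 2 + k, the inequality 2i ≤ 2ⁱ is equivalent to i - 1 ≤ 2ⁱ - i - 1, that is, to the
  -- factor of q being at most 1.
  2[2+k]≤2^[2+k] : ∀ k → 2 ℕ.* (2 ℕ.+ k) ℕ.≤ 2 ^ (2 ℕ.+ k)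
  2[2+k]≤2^[2+k] zero    = ℕ.≤-refl
  2[2+k]≤2^[2+k] (suc k) = ℕ.*-monoʳ-≤ 2 (begin
    3 ℕ.+ k             ≤⟨ ℕ.s≤s (ℕ.s≤s (ℕ.s≤s (ℕ.m≤m+n k (suc (k ℕ.+ 0))))) ⟩
    suc (suc (suc (k ℕ.+ suc (k ℕ.+ 0)))) ≤⟨ ℕ.s≤s (ℕ.s≤s (ℕ.≤-reflexive (sym (ℕ.+-suc k (suc (k ℕ.+ 0)))))) ⟩
    2 ℕ.* (2 ℕ.+ k)     ≤⟨ 2[2+k]≤2^[2+k] k ⟩
    2 ^ (2 ℕ.+ k)       ∎)
    where open ℕ.≤-Reasoning

  denominator-+ : ∀ k → denominator k ℕ.+ (3 ℕ.+ k) ≡ 2 ^ (2 ℕ.+ k)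
  denominator-+ k rewrite ℕ.+-comm k 2 | ℕ.∸-+-assoc (2 ^ (2 ℕ.+ k)) (2 ℕ.+ k) 2 = begin
    suc (r ℕ.+ (3 ℕ.+ k))       ≡⟨ ℕ.+-suc r (3 ℕ.+ k) ⟨
    r ℕ.+ (4 ℕ.+ k)             ≡⟨ cong (r ℕ.+_) (cong (λ z → 2 ℕ.+ z) (ℕ.+-comm 2 k)) ⟩
    r ℕ.+ (2 ℕ.+ k ℕ.+ 2)       ≡⟨ ℕ.m∸n+n≡m le ⟩
    2 ^ (2 ℕ.+ k)               ∎
    where
    open ≡-Reasoning
    r = 2 ^ (2 ℕ.+ k) ∸ (2 ℕ.+ k ℕ.+ 2)
    le : 2 ℕ.+ k ℕ.+ 2 ℕ.≤ 2 ^ (2 ℕ.+ k)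
    le = ℕ.≤-trans (ℕ.+-monoʳ-≤ (2 ℕ.+ k) (ℕ.≤-trans (ℕ.m≤m+n 2 k) (ℕ.m≤m+n (2 ℕ.+ k) 0))) (2[2+k]≤2^[2+k] k)

  1+k≤denominator : ∀ k → suc k ℕ.≤ denominator k
  1+k≤denominator k = ℕ.+-cancelʳ-≤ (3 ℕ.+ k) (suc k) (denominator k) (begin
    suc k ℕ.+ (3 ℕ.+ k)        ≡⟨ ℕ.+-suc (suc k) (2 ℕ.+ k) ⟩
    2 ℕ.+ k ℕ.+ (2 ℕ.+ k)      ≡⟨ cong (2 ℕ.+ k ℕ.+_) (ℕ.+-identityʳ (2 ℕ.+ k)) ⟨
    2 ℕ.* (2 ℕ.+ k)            ≤⟨ 2[2+k]≤2^[2+k] k ⟩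
    2 ^ (2 ℕ.+ k)              ≡⟨ denominator-+ k ⟨
    denominator k ℕ.+ (3 ℕ.+ k) ∎)
    where open ℕ.≤-Reasoning

  factor-*-ι : ∀ k → factor k * ι (denominator k) ≡ ι (suc k)
  factor-*-ι k = /-*-ι (suc k) (2 ^ (k ℕ.+ 2) ∸ (k ℕ.+ 2) ∸ 2)

  factor-nonNeg : ∀ k → 0ℚ ≤ factor k
  factor-nonNeg k = nonNegative⁻¹ (factor k) {{normalize-nonNeg (suc k) (denominator k)}}

  factor≤1 : ∀ k → factor k ≤ 1ℚ
  factor≤1 k = *-cancelʳ-≤-pos (ι (denominator k)) {{normalize-pos (denominator k) 1}} (begin
    factor k * ι (denominator k) ≡⟨ factor-*-ι k ⟩
    ι (suc k)                    ≤⟨ ι-mono (1+k≤denominator k) ⟩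
    ι (denominator k)            ≡⟨ *-identityˡ (ι (denominator k)) ⟨
    1ℚ * ι (denominator k)       ∎)
    where open ≤-Reasoning

  prodQ-bounds : ∀ k → 0ℚ ≤ prodQ (suc k) × prodQ (suc k) ≤ 1ℚ
  prodQ-bounds zero    = nonNegative⁻¹ 1ℚ , ≤-refl
  prodQ-bounds (suc k) with prodQ-bounds k
  ... | 0≤ , ≤1 = *-nonNeg 0≤ (factor-nonNeg k) , (begin
    prodQ (suc k) * factor k ≤⟨ *-monoˡ 0≤ (factor≤1 k) ⟩
    prodQ (suc k) * 1ℚ       ≡⟨ *-identityʳ (prodQ (suc k)) ⟩
    prodQ (suc k)            ≤⟨ ≤1 ⟩
    1ℚ                       ∎)
    where open ≤-Reasoning

  E-bounds : ∀ m → 0ℚ ≤ E m × E m ≤ ι (suc m) * ½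
  E-bounds m = *-nonNeg (ι-nonNeg (suc m)) (*-nonNeg 0≤½ (proj₁ (prodQ-bounds m))) ,
    *-monoˡ (ι-nonNeg (suc m)) (subst (½ * prodQ (suc m) ≤_) (*-identityʳ ½) (*-monoˡ 0≤½ (proj₂ (prodQ-bounds m))))

  -- For i = m + 2, split 2ⁱ into `denominator m` and i + 1. The share i + 1 is the first term of
  -- `mix`; the other cancels the denominator of the last factor of `q i` and leaves i · (i - 1) ·
  -- `q (i − 1)`, the second term.
  E-suc : ∀ m → E (suc m) ≡ mix m (E (suc m)) (E m)
  E-suc m = begin
    L                                       ≡⟨ *-identityˡ L ⟨
    1ℚ * L                                  ≡⟨ cong (_* L) (half^-2^ (2 ℕ.+ m)) ⟨
    h * ι (2 ^ (2 ℕ.+ m)) * L               ≡⟨ cong (λ z → h * ι z * L) (denominator-+ m) ⟨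
    h * ι (denominator m ℕ.+ (3 ℕ.+ m)) * L ≡⟨ cong (λ z → h * z * L) (ι-+ (denominator m) (3 ℕ.+ m)) ⟩
    h * (d + ι (3 ℕ.+ m)) * L
      ≡⟨ solve 6 (λ h d c y x f →
           h :* (d :+ c) :* (y :* (con ½ :* (x :* f))) :=
           h :* (c :* (y :* (con ½ :* (x :* f))) :+ y :* (f :* d :* (con ½ :* x))))
         refl h d (ι (3 ℕ.+ m)) (ι (2 ℕ.+ m)) (prodQ (suc m)) (factor m) ⟩
    h * (ι (3 ℕ.+ m) * L + ι (2 ℕ.+ m) * (factor m * d * q (suc m)))
      ≡⟨ cong (λ z → h * (ι (3 ℕ.+ m) * L + ι (2 ℕ.+ m) * (z * q (suc m)))) (factor-*-ι m) ⟩
    mix m L (E m) ∎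
    where
    open ≡-Reasoning
    h = half^ (2 ℕ.+ m)
    d = ι (denominator m)
    L = E (suc m)

  p₀-E : ∀ n → ∣ p 0 (suc n) - E 0 ∣ ≡ 0ℚ
  p₀-E n rewrite p₀ n = refl

  -- One contraction lowers `n` by at most `K`, so `j` of them fit if `n` exceeds `j * K`. The
  -- strict inequality keeps the remaining argument positive, where `p 0` equals its limit.
  error : ∀ K j m n → m ℕ.< K → suc (j ℕ.* K) ℕ.≤ n → ∣ p m n - E m ∣ ≤ ι (suc m) * (½ * ¾^ j)
  error K zero m n _ _ = subst (∣ p m n - E m ∣ ≤_) (cong (ι (suc m) *_) (sym (*-identityʳ ½)))
    (∣-∣-bounded (proj₁ (p-bounds n m)) (proj₂ (p-bounds n m)) (proj₁ (E-bounds m)) (proj₂ (E-bounds m)))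
  error K (suc j) zero (suc n) _ _ = subst (_≤ ι 1 * (½ * ¾^ (suc j))) (sym (p₀-E n))
    (*-nonNeg (ι-nonNeg 1) (*-nonNeg 0≤½ (¾^-nonNeg (suc j))))
  error K (suc j) (suc m) n 2+m≤K le = begin
    ∣ p (suc m) n - E (suc m) ∣                        ≡⟨ cong (λ n → ∣ p (suc m) n - E (suc m) ∣) (ℕ.m+[n∸m]≡n 2+m≤n) ⟨
    ∣ p (suc m) (2 ℕ.+ m ℕ.+ k) - E (suc m) ∣          ≡⟨ cong₂ (λ x y → ∣ x - y ∣) (p-suc m k) (E-suc m) ⟩
    ∣ mix m (p (suc m) k) (p m k) - mix m (E (suc m)) (E m) ∣ ≤⟨ mix-∣-∣ m (p (suc m) k) (p m k) (E (suc m)) (E m) ⟩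
    mix m ∣ p (suc m) k - E (suc m) ∣ ∣ p m k - E m ∣  ≤⟨ contract m k≥ (error K j (suc m) k 2+m≤K k≥) (error K j m k (ℕ.<⇒≤ 2+m≤K) k≥) ⟩
    ¾ * (ι (2 ℕ.+ m) * (½ * ¾^ j))                     ≡⟨ solve 2 (λ y r → con ¾ :* (y :* (con ½ :* r)) := y :* (con ½ :* (con ¾ :* r))) refl (ι (2 ℕ.+ m)) (¾^ j) ⟩
    ι (2 ℕ.+ m) * (½ * ¾^ (suc j))                     ∎
    where
    open ≤-Reasoning
    k = n ∸ (2 ℕ.+ m)
    2+m≤n : 2 ℕ.+ m ℕ.≤ n
    2+m≤n = ℕ.≤-trans 2+m≤K (ℕ.≤-trans (ℕ.m≤m+n K (j ℕ.* K)) (ℕ.<⇒≤ le))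
    k≥ : suc (j ℕ.* K) ℕ.≤ k
    k≥ = ℕ.≤-trans (ℕ.≤-reflexive (sym (ℕ.m+n∸m≡n K (suc (j ℕ.* K)))))
      (ℕ.∸-mono (ℕ.≤-trans (ℕ.≤-reflexive (ℕ.+-suc K (j ℕ.* K))) le) 2+m≤K)
    δ = ½ * ¾^ j
    -- For m = 0 the weight is 1, but then the second term vanishes.
    contract : ∀ m {k x} → suc (j ℕ.* K) ℕ.≤ k → x ≤ ι (2 ℕ.+ m) * δ → ∣ p m k - E m ∣ ≤ ι (1 ℕ.+ m) * δ →
               mix m x ∣ p m k - E m ∣ ≤ ¾ * (ι (2 ℕ.+ m) * δ)
    contract zero {suc k} {x} _ hx _ = begin
      mix 0 x ∣ p 0 (suc k) - E 0 ∣ ≡⟨ cong (mix 0 x) (p₀-E k) ⟩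
      mix 0 x 0ℚ                    ≡⟨ solve 1 (λ x → con (half^ 2) :* (con (ι 3) :* x :+ con (ι 2) :* con 0ℚ) := con ¾ :* x) refl x ⟩
      ¾ * x                         ≤⟨ *-monoˡ 0≤¾ hx ⟩
      ¾ * (ι 2 * δ)                 ∎
    contract (suc m) {k} {x} _ hx hy = begin
      mix (suc m) x ∣ p (suc m) k - E (suc m) ∣       ≤⟨ mix-mono (suc m) hx hy ⟩
      mix (suc m) (ι (3 ℕ.+ m) * δ) (ι (2 ℕ.+ m) * δ) ≡⟨ mix-linear (suc m) δ ⟩
      weight (suc m) * (ι (3 ℕ.+ m) * δ)              ≤⟨ *-monoʳ (*-nonNeg (ι-nonNeg (3 ℕ.+ m)) (*-nonNeg 0≤½ (¾^-nonNeg j))) (weight≤¾ m) ⟩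
      ¾ * (ι (3 ℕ.+ m) * δ)                           ∎

-- Summation over the number of blocks

module Summation where

  open import Data.Nat as ℕ using (ℕ; zero; suc; _∸_)
  import Data.Nat.Properties as ℕ
  open import Data.Integer using (+_)
  open import Data.Rational
  open import Data.Rational.Properties
  open import Data.Rational.Solver using (module +-*-Solver)
  open import Data.Product using (_×_; _,_; proj₁; proj₂)
  open import Data.Sum using (inj₁; inj₂)
  open import Relation.Binary.PropositionalEquality
  open +-*-Solver
  open Counting
  open Rationals
  open Asymptotics

  S : (ℕ → ℚ) → ℕ → ℚ
  S f zero    = 0ℚ
  S f (suc k) = S f k + f k

  -- The contributions of m + 1 blocks to B n / 2ⁿ and to γ_B; both lie between 0 and c m, and
  -- tail K = Σ_{m ≥ K} c m.
  b : ℕ → ℕ → ℚ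
  b n m = half^ (1 ℕ.+ m) * p m (n ∸ (1 ℕ.+ m)) + half^ (2 ℕ.+ m) * p m (n ∸ (2 ℕ.+ m))

  G : ℕ → ℚ
  G m = half^ (1 ℕ.+ m) * E m + half^ (2 ℕ.+ m) * E m

  c : ℕ → ℚ
  c m = ¾ * (half^ (1 ℕ.+ m) * ι (1 ℕ.+ m))

  tail : ℕ → ℚ
  tail K = ¾ * (half^ K * ι (2 ℕ.+ K))

  γB-partial≡S : ∀ M → γB-partial M ≡ S G M
  γB-partial≡S zero    = refl
  γB-partial≡S (suc M) = begin
    + 3 / 2 * (partial M + E M * half^ (suc M))
      ≡⟨ solve 3 (λ P e h → con (+ 3 / 2) :* (P :+ e :* (con ½ :* h)) :=
           con (+ 3 / 2) :* P :+ (con ½ :* h :* e :+ con ½ :* (con ½ :* h) :* e)) refl (partial M) (E M) (half^ M) ⟩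
    γB-partial M + G M     ≡⟨ cong (_+ G M) (γB-partial≡S M) ⟩
    S G M + G M            ∎
    where open ≡-Reasoning

  -- Truncated subtraction is harmless: for `n ≤ d` both sides vanish, as no word with a block has
  -- cost 0.
  shift-half : ∀ m d n → ι (A (suc m) (n ∸ d)) * half^ n ≡ half^ d * p m (n ∸ d)
  shift-half m d n with ℕ.≤-total d n
  ... | inj₁ d≤n = begin
    a * half^ n                          ≡⟨ cong (λ j → a * half^ j) (ℕ.m+[n∸m]≡n d≤n) ⟨
    a * half^ (d ℕ.+ (n ∸ d))            ≡⟨ cong (a *_) (half^-+ d (n ∸ d)) ⟩
    a * (half^ d * half^ (n ∸ d))        ≡⟨ solve 3 (λ a h k → a :* (h :* k) := h :* (a :* k)) refl a (half^ d) (half^ (n ∸ d)) ⟩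
    half^ d * p m (n ∸ d)                ∎
    where
    open ≡-Reasoning
    a = ι (A (suc m) (n ∸ d))
  ... | inj₂ n≤d rewrite ℕ.m≤n⇒m∸n≡0 n≤d | A-suc-zero m =
    trans (*-zeroˡ (half^ n)) (sym (*-zeroʳ (half^ d)))

  term-half : ∀ n m → ι (term n m) * half^ n ≡ b n m
  term-half n m = begin
    ι (x ℕ.+ y) * half^ n             ≡⟨ cong (_* half^ n) (ι-+ x y) ⟩
    (ι x + ι y) * half^ n             ≡⟨ *-distribʳ-+ (half^ n) (ι x) (ι y) ⟩
    ι x * half^ n + ι y * half^ n     ≡⟨ cong₂ _+_ (shift-half m (1 ℕ.+ m) n) (shift-half m (2 ℕ.+ m) n) ⟩
    b n m                             ∎
    where
    open ≡-Reasoning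
    x = A (suc m) (n ∸ (1 ℕ.+ m))
    y = A (suc m) (n ∸ (2 ℕ.+ m))

  ∑-half : ∀ n k → ι (∑ k (term n)) * half^ n ≡ S (b n) k
  ∑-half n zero    = *-zeroˡ (half^ n)
  ∑-half n (suc k) = begin
    ι (∑ (suc k) (term n)) * half^ n                     ≡⟨ cong (λ z → ι z * half^ n) (∑-last k (term n)) ⟩
    ι (∑ k (term n) ℕ.+ term n k) * half^ n              ≡⟨ cong (_* half^ n) (ι-+ (∑ k (term n)) (term n k)) ⟩
    (ι (∑ k (term n)) + ι (term n k)) * half^ n          ≡⟨ *-distribʳ-+ (half^ n) (ι (∑ k (term n))) (ι (term n k)) ⟩
    ι (∑ k (term n)) * half^ n + ι (term n k) * half^ n  ≡⟨ cong₂ _+_ (∑-half n k) (term-half n k) ⟩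
    S (b n) (suc k)                                      ∎
    where open ≡-Reasoning

  combine-bounds : ∀ m {x y} → 0ℚ ≤ x → x ≤ ι (suc m) * ½ → 0ℚ ≤ y → y ≤ ι (suc m) * ½ →
                   0ℚ ≤ half^ (1 ℕ.+ m) * x + half^ (2 ℕ.+ m) * y × half^ (1 ℕ.+ m) * x + half^ (2 ℕ.+ m) * y ≤ c m
  combine-bounds m {x} {y} 0≤x x≤ 0≤y y≤ =
    +-nonNeg (*-nonNeg (half^-nonNeg (1 ℕ.+ m)) 0≤x) (*-nonNeg (half^-nonNeg (2 ℕ.+ m)) 0≤y) , (begin
      half^ (1 ℕ.+ m) * x + half^ (2 ℕ.+ m) * y
        ≤⟨ +-mono-≤ (*-monoˡ (half^-nonNeg (1 ℕ.+ m)) x≤) (*-monoˡ (half^-nonNeg (2 ℕ.+ m)) y≤) ⟩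
      half^ (1 ℕ.+ m) * (ι (suc m) * ½) + half^ (2 ℕ.+ m) * (ι (suc m) * ½)
        ≡⟨ solve 2 (λ h z → h :* (z :* con ½) :+ con ½ :* h :* (z :* con ½) := con ¾ :* (h :* z)) refl (half^ (1 ℕ.+ m)) (ι (suc m)) ⟩
      c m ∎)
    where open ≤-Reasoning

  b-bounds : ∀ n m → 0ℚ ≤ b n m × b n m ≤ c m
  b-bounds n m = combine-bounds m (proj₁ (p-bounds _ m)) (proj₂ (p-bounds (n ∸ (1 ℕ.+ m)) m))
                                  (proj₁ (p-bounds _ m)) (proj₂ (p-bounds (n ∸ (2 ℕ.+ m)) m))

  G-bounds : ∀ m → 0ℚ ≤ G m × G m ≤ c m
  G-bounds m = combine-bounds m (proj₁ (E-bounds m)) (proj₂ (E-bounds m)) (proj₁ (E-bounds m)) (proj₂ (E-bounds m))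

  b-G : ∀ K j n m → m ℕ.< K → suc (j ℕ.* K) ℕ.≤ n ∸ (2 ℕ.+ m) → ∣ b n m - G m ∣ ≤ c m * ¾^ j
  b-G K j n m m<K le = begin
    ∣ b n m - G m ∣
      ≡⟨ cong ∣_∣ (solve 5 (λ h k x y e → (h :* x :+ k :* y) :- (h :* e :+ k :* e) := h :* (x :- e) :+ k :* (y :- e))
           refl h₁ h₂ (p m (n ∸ (1 ℕ.+ m))) (p m (n ∸ (2 ℕ.+ m))) (E m)) ⟩
    ∣ h₁ * (p m (n ∸ (1 ℕ.+ m)) - E m) + h₂ * (p m (n ∸ (2 ℕ.+ m)) - E m) ∣
      ≤⟨ ∣+∣-mono (∣*∣-mono (half^-nonNeg (1 ℕ.+ m)) (error K j m _ m<K (ℕ.≤-trans le (ℕ.∸-monoʳ-≤ n (ℕ.n≤1+n (1 ℕ.+ m))))))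
                  (∣*∣-mono (half^-nonNeg (2 ℕ.+ m)) (error K j m _ m<K le)) ⟩
    h₁ * (ι (suc m) * (½ * ¾^ j)) + h₂ * (ι (suc m) * (½ * ¾^ j))
      ≡⟨ solve 3 (λ h z r → h :* (z :* (con ½ :* r)) :+ con ½ :* h :* (z :* (con ½ :* r)) := con ¾ :* (h :* z) :* r)
           refl h₁ (ι (suc m)) (¾^ j) ⟩
    c m * ¾^ j ∎
    where
    open ≤-Reasoning
    h₁ = half^ (1 ℕ.+ m)
    h₂ = half^ (2 ℕ.+ m)

  tail-suc : ∀ K → c K + tail (suc K) ≡ tail K
  tail-suc K = begin
    c K + tail (suc K)
      ≡⟨ cong₂ (λ u v → ¾ * (½ * h * u) + ¾ * (½ * h * v)) (ι-+ 1 K) (ι-+ 3 K) ⟩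
    ¾ * (½ * h * (ι 1 + ι K)) + ¾ * (½ * h * (ι 3 + ι K))
      ≡⟨ solve 2 (λ h x → con ¾ :* (con ½ :* h :* (con (ι 1) :+ x)) :+ con ¾ :* (con ½ :* h :* (con (ι 3) :+ x))
           := con ¾ :* (h :* (con (ι 2) :+ x))) refl h (ι K) ⟩
    ¾ * (h * (ι 2 + ι K))  ≡⟨ cong (λ u → ¾ * (h * u)) (ι-+ 2 K) ⟨
    tail K                 ∎
    where
    open ≡-Reasoning
    h = half^ K

  tail-nonNeg : ∀ K → 0ℚ ≤ tail K
  tail-nonNeg K = *-nonNeg 0≤¾ (*-nonNeg (half^-nonNeg K) (ι-nonNeg (2 ℕ.+ K)))

  -- Consecutive tails have ratio (K + 3) / (2 (K + 2)) ≤ 3/4. This puts the truncation errors on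
  -- the same geometric scale as the contraction.
  tail≤ : ∀ K → tail K ≤ (+ 3 / 2) * ¾^ K
  tail≤ zero    = ≤-refl
  tail≤ (suc K) = begin
    ¾ * (½ * h * ι (3 ℕ.+ K))
      ≤⟨ p≤q+p (*-nonNeg (nonNegative⁻¹ (+ 3 / 16)) (*-nonNeg (half^-nonNeg K) (ι-nonNeg K))) ⟩
    (+ 3 / 16) * (h * ι K) + ¾ * (½ * h * ι (3 ℕ.+ K))
      ≡⟨ cong (λ u → (+ 3 / 16) * (h * ι K) + ¾ * (½ * h * u)) (ι-+ 3 K) ⟩
    (+ 3 / 16) * (h * ι K) + ¾ * (½ * h * (ι 3 + ι K))
      ≡⟨ solve 2 (λ h x → con (+ 3 / 16) :* (h :* x) :+ con ¾ :* (con ½ :* h :* (con (ι 3) :+ x))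
           := con ¾ :* (con ¾ :* (h :* (con (ι 2) :+ x)))) refl h (ι K) ⟩
    ¾ * (¾ * (h * (ι 2 + ι K)))   ≡⟨ cong (λ u → ¾ * (¾ * (h * u))) (ι-+ 2 K) ⟨
    ¾ * tail K                    ≤⟨ *-monoˡ 0≤¾ (tail≤ K) ⟩
    ¾ * ((+ 3 / 2) * ¾^ K)        ≡⟨ solve 1 (λ r → con ¾ :* (con (+ 3 / 2) :* r) := con (+ 3 / 2) :* (con ¾ :* r)) refl (¾^ K) ⟩
    (+ 3 / 2) * ¾^ (suc K)        ∎
    where
    open ≤-Reasoning
    h = half^ K

  module _ (f : ℕ → ℚ) (bounds : ∀ m → 0ℚ ≤ f m × f m ≤ c m) where

    S-mono : ∀ K d → S f K ≤ S f (d ℕ.+ K)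
    S-mono K zero    = ≤-refl
    S-mono K (suc d) = ≤-trans (S-mono K d)
      (subst (_≤ S f (suc d ℕ.+ K)) (+-identityʳ (S f (d ℕ.+ K))) (+-monoʳ-≤ (S f (d ℕ.+ K)) (proj₁ (bounds (d ℕ.+ K)))))

    -- A new term is at most `c k`, exactly the amount by which `tail` drops; so no infinite sum has
    -- to be formed.
    S-tail : ∀ K d → S f (d ℕ.+ K) + tail (d ℕ.+ K) ≤ S f K + tail K
    S-tail K zero    = ≤-refl
    S-tail K (suc d) = begin
      S f k + f k + tail (suc k)     ≡⟨ +-assoc (S f k) (f k) (tail (suc k)) ⟩
      S f k + (f k + tail (suc k))   ≤⟨ +-monoʳ-≤ (S f k) (+-monoˡ-≤ (tail (suc k)) (proj₂ (bounds k))) ⟩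
      S f k + (c k + tail (suc k))   ≡⟨ cong (_+_ (S f k)) (tail-suc k) ⟩
      S f k + tail k                 ≤⟨ S-tail K d ⟩
      S f K + tail K                 ∎
      where
      open ≤-Reasoning
      k = d ℕ.+ K

    S-truncate : ∀ {K n} → K ℕ.≤ n → ∣ S f n - S f K ∣ ≤ tail K
    S-truncate {K} {n} K≤n = subst (λ n → ∣ S f n - S f K ∣ ≤ tail K) (ℕ.m∸n+n≡m K≤n) (∣-∣-≤
      (begin
        S f k                ≤⟨ p≤q+p (tail-nonNeg k) ⟩
        tail k + S f k       ≡⟨ +-comm (tail k) (S f k) ⟩
        S f k + tail k       ≤⟨ S-tail K (n ∸ K) ⟩
        S f K + tail K       ≡⟨ +-comm (S f K) (tail K) ⟩
        tail K + S f K       ∎)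
      (≤-trans (S-mono K (n ∸ K)) (p≤q+p (tail-nonNeg K))))
      where
      open ≤-Reasoning
      k = n ∸ K ℕ.+ K

  -- Out of the budget `tail 0 * r`, each term spends at most `c m * r`; `tail K * r` is what is
  -- left, carried along to make the induction exact.
  S-head : ∀ f g r K → (∀ m → m ℕ.< K → ∣ f m - g m ∣ ≤ c m * r) → ∣ S f K - S g K ∣ + tail K * r ≤ tail 0 * r
  S-head f g r zero    h = ≤-reflexive (+-identityˡ (tail 0 * r))
  S-head f g r (suc K) h = begin
    ∣ S f K + f K - (S g K + g K) ∣ + t * r
      ≡⟨ cong (λ z → ∣ z ∣ + t * r) (solve 4 (λ a b x y → (a :+ x) :- (b :+ y) := (a :- b) :+ (x :- y)) refl (S f K) (S g K) (f K) (g K)) ⟩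
    ∣ S f K - S g K + (f K - g K) ∣ + t * r        ≤⟨ +-monoˡ-≤ (t * r) (∣+∣-mono {S f K - S g K} {f K - g K} ≤-refl (h K ℕ.≤-refl)) ⟩
    ∣ S f K - S g K ∣ + c K * r + t * r            ≡⟨ solve 4 (λ s c t r → s :+ c :* r :+ t :* r := s :+ (c :+ t) :* r) refl ∣ S f K - S g K ∣ (c K) t r ⟩
    ∣ S f K - S g K ∣ + (c K + t) * r              ≡⟨ cong (λ z → ∣ S f K - S g K ∣ + z * r) (tail-suc K) ⟩
    ∣ S f K - S g K ∣ + tail K * r                 ≤⟨ S-head f g r K (λ m m<K → h m (ℕ.<-trans m<K ℕ.≤-refl)) ⟩
    tail 0 * r                                     ∎
    where
    open ≤-Reasoning
    t = tail (suc K)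

  -- `K` contractions of length at most `K` need an argument above `K * K`, and the summands of `b`
  -- with `m < K` evaluate `p` at `n` reduced by at most `2 + K`.
  threshold : ℕ → ℕ
  threshold K = 2 ℕ.+ K ℕ.+ suc (K ℕ.* K)

  K≤threshold : ∀ K → K ℕ.≤ threshold K
  K≤threshold K = ℕ.≤-trans (ℕ.m≤n+m K 2) (ℕ.m≤m+n (2 ℕ.+ K) (suc (K ℕ.* K)))

  -- Three errors of at most 3/2 · (3/4)ᴷ each: truncating the sum for `n` at `K`, passing to the
  -- limit in the first `K` terms, and truncating the limit series. The middle one uses `tail 0` =
  -- 3/2.
  total-error : ∀ K n M → threshold K ℕ.≤ n → K ℕ.≤ M → ∣ S (b n) n - S G M ∣ ≤ (+ 9 / 2) * ¾^ K
  total-error K n M N≤n K≤M = begin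
    ∣ S (b n) n - S G M ∣
      ≡⟨ cong ∣_∣ (solve 4 (λ w x y z → w :- z := (w :- x) :+ ((x :- y) :+ (y :- z))) refl (S (b n) n) (S (b n) K) (S G K) (S G M)) ⟩
    ∣ (S (b n) n - S (b n) K) + ((S (b n) K - S G K) + (S G K - S G M)) ∣
      ≤⟨ ∣+∣-mono (≤-trans (S-truncate (b n) (b-bounds n) (ℕ.≤-trans (K≤threshold K) N≤n)) (tail≤ K))
           (∣+∣-mono head (≤-trans back (tail≤ K))) ⟩
    r + (tail 0 * ¾^ K + r)
      ≡⟨ solve 1 (λ x → con (+ 3 / 2) :* x :+ (con (tail 0) :* x :+ con (+ 3 / 2) :* x) := con (+ 9 / 2) :* x) refl (¾^ K) ⟩
    (+ 9 / 2) * ¾^ K ∎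
    where
    open ≤-Reasoning
    r = (+ 3 / 2) * ¾^ K
    late : ∀ m → m ℕ.< K → suc (K ℕ.* K) ℕ.≤ n ∸ (2 ℕ.+ m)
    late m m<K = ℕ.≤-trans (ℕ.≤-reflexive (sym (ℕ.m+n∸m≡n (2 ℕ.+ K) (suc (K ℕ.* K)))))
      (ℕ.∸-mono N≤n (ℕ.+-monoʳ-≤ 2 (ℕ.<⇒≤ m<K)))
    head : ∣ S (b n) K - S G K ∣ ≤ tail 0 * ¾^ K
    head = begin
      ∣ S (b n) K - S G K ∣                        ≤⟨ p≤q+p (*-nonNeg (tail-nonNeg K) (¾^-nonNeg K)) ⟩
      tail K * ¾^ K + ∣ S (b n) K - S G K ∣        ≡⟨ +-comm (tail K * ¾^ K) ∣ S (b n) K - S G K ∣ ⟩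
      ∣ S (b n) K - S G K ∣ + tail K * ¾^ K        ≤⟨ S-head (b n) G (¾^ K) K (λ m m<K → b-G K K n m m<K (late m m<K)) ⟩
      tail 0 * ¾^ K                                ∎
    back : ∣ S G K - S G M ∣ ≤ tail K
    back = subst (_≤ tail K)
      (trans (sym (∣-p∣≡∣p∣ (S G M - S G K))) (cong ∣_∣ (solve 2 (λ x y → :- (x :- y) := y :- x) refl (S G M) (S G K))))
      (S-truncate G G-bounds K≤M)

  -- By `¾^-bound` the left side is at most (9/2) · 3 / (3 + K), and 14 is the least integer above
  -- 27/2.
  small : ∀ ε d → 0ℚ ≤ ε → 1ℚ ≤ ε * ι d → (+ 9 / 2) * ¾^ (14 ℕ.* d) ≤ ε
  small ε d 0≤ε 1≤εd = *-cancelʳ-≤-pos (ι (3 ℕ.+ K)) {{normalize-pos (3 ℕ.+ K) 1}} (begin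
    (+ 9 / 2) * ¾^ K * ι (3 ℕ.+ K)      ≡⟨ *-assoc (+ 9 / 2) (¾^ K) (ι (3 ℕ.+ K)) ⟩
    (+ 9 / 2) * (¾^ K * ι (3 ℕ.+ K))    ≤⟨ *-monoˡ (nonNegative⁻¹ (+ 9 / 2)) (¾^-bound K) ⟩
    (+ 9 / 2) * ι 3                     ≤⟨ p≤q+p (nonNegative⁻¹ ½) ⟩
    ι 14 * 1ℚ                           ≤⟨ *-monoˡ (ι-nonNeg 14) 1≤εd ⟩
    ι 14 * (ε * ι d)                    ≡⟨ solve 2 (λ e d → con (ι 14) :* (e :* d) := e :* (con (ι 14) :* d)) refl ε (ι d) ⟩
    ε * (ι 14 * ι d)                    ≡⟨ cong (ε *_) (ι-* 14 d) ⟨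
    ε * ι K                             ≤⟨ *-monoˡ 0≤ε (ι-mono (ℕ.m≤n+m K 3)) ⟩
    ε * ι (3 ℕ.+ K)                     ∎)
    where
    open ≤-Reasoning
    K = 14 ℕ.* d

-- The limit, with γ_B represented by its rational partial sums

open import Data.Nat using (ℕ; _≥_)
open import Data.Integer using (+_)
open import Data.Rational using (ℚ; _/_; _*_; _-_; ∣_∣; _≤_; _<_; 0ℚ)
open import Data.Product using (∃; _,_)
import Data.Nat as ℕ
import Data.Nat.Properties as ℕ
open import Data.Rational.Properties using (≤-trans; <⇒≤)
open import Relation.Binary.PropositionalEquality using (_≡_; sym; trans; cong; cong₂; subst)

theorem7p5 : (B : ℕ → ℕ) → (∀ n → n ≥ 1 → CountIs n (B n)) →
    ∀ (ε : ℚ) → 0ℚ < ε → ∃ λ N → ∀ n M → n ≥ N → M ≥ N →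
    ∣ ((+ B n) / 1) * half^ n - γB-partial M ∣ ≤ ε
theorem7p5 B counts ε 0<ε with Rationals.archimedean ε 0<ε
-- One bound serves both indices: `threshold K` is large enough for the contractions in `n`, and it
-- exceeds `K`, which is all that `M` has to reach.
... | d , 1≤εd = threshold K , λ n M N≤n N≤M →
  subst (λ x → ∣ x ∣ ≤ ε) (sym (cong₂ _-_ (B-half n N≤n) (γB-partial≡S M)))
    (≤-trans (total-error K n M N≤n (ℕ.≤-trans (K≤threshold K) N≤M)) (small ε d (<⇒≤ 0<ε) 1≤εd))
  where
  open Summation
  K = 14 ℕ.* d
  B-half : ∀ n → n ≥ threshold K → ((+ B n) / 1) * half^ n ≡ S (b n) n
  B-half n N≤n = trans
    (cong (λ k → ((+ k) / 1) * half^ n) (Counting.count 2≤n (counts n (ℕ.<⇒≤ 2≤n))))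
    (∑-half n n)
    where
    2≤n : n ≥ 2
    2≤n = ℕ.≤-trans (ℕ.s≤s (ℕ.s≤s ℕ.z≤n)) N≤n
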